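{- Let $n\ge r\ge 2$ be integers and let $T$ be a tight $r$-tree with $t\le 4$ edges. Then $$\mathrm{ex}_r(n,T)\le\frac{t-1}{r}\binom{n}{r-1}.$$
   Context: An $r$-graph is a (finite) $r$-uniform hypergraph. An $r$-graph $T$ is a tight $r$-tree if its edges can be ordered as $e_1,\dots,e_t$ ($t\ge 1$) so that for each $i\ge 2$ there are a vertex $v\in e_i$ and an index $1\le s\le i-1$ such that $v\notin\bigcup_{j=1}^{i-1}e_j$ and $e_i\setminus\{v\}\subset e_s$. The vertex set of a tight tree is the union of its edges. An $r$-graph $G$ contains $H$ if there is an injection $V(H)\to V(G)$ mapping every edge of $H$ to an edge of $G$. $\mathrm{ex}_r(n,H)$ is the largest $m$ such that there exists an $n$-vertex $r$-graph with $m$ edges that does not contain $H$. -}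

module Defs where

open import Data.Bool.Base using (true; false; if_then_else_)
import Data.Bool.Properties as Bool
open import Data.Fin.Base as Fin using (Fin; zero; suc; toℕ; combine; finToFun; funToFin)
import Data.Fin.Properties as Fin
open import Data.Fin.Subset using (Subset; _∈_; _∉_; _⊆_; _-_; ∣_∣)
open import Data.Fin.Subset.Properties using (_∈?_; anySubset?)
open import Data.List.Base as List using (List; []; _∷_; length)
import Data.List.Membership.DecPropositional as DecMembership
import Data.List.Membership.Propositional as Membership
open import Data.List.Membership.Propositional.Properties using (∈-lookup)
open import Data.List.Relation.Binary.Permutation.Propositional using (_↭_)
open import Data.List.Relation.Unary.All as All using (All; []; _∷_)
import Data.List.Relation.Unary.AllPairs as AllPairs
open import Data.List.Relation.Unary.Unique.Propositional using (Unique)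
import Data.List.Relation.Unary.Unique.DecPropositional as DecUnique
open import Data.Nat.Base using (ℕ; zero; suc; _≤_; _<_; s≤s⁻¹; _^_)
import Data.Nat.Properties as ℕ
open import Data.Product.Base using (∃; ∃-syntax; _×_; _,_)
open import Data.Sum.Base using (inj₁; inj₂)
open import Data.Vec.Base using ([]; _∷_; tabulate)
import Data.Vec.Properties as Vec
open import Function.Base using (_∘_)
open import Function.Definitions using (Injective)
open import Level using (0ℓ)
open import Relation.Binary.Definitions using (DecidableEquality)
open import Relation.Binary.PropositionalEquality
open import Relation.Nullary.Decidable using (Dec; yes; no; does; map′; ¬?; _×-dec_; _→-dec_)
open import Relation.Nullary.Negation using (¬_; contradiction)
open import Relation.Unary using (Pred; Decidable)

-- r-graphs with vertex set Fin n.  The edge set is a duplicate-free list, so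
-- that its length is the number of edges; the order of the list is irrelevant.

record RGraph (r n : ℕ) : Set where
  field
    edges   : List (Subset n)
    unique  : Unique edges
    uniform : All (λ e → ∣ e ∣ ≡ r) edges

  size : ℕ
  size = length edges

open RGraph public

record TightOrdering {n} (es : List (Subset n)) : Set where
  private
    e : Fin (length es) → Subset n
    e = List.lookup es
  field
    nonempty : 0 < length es
    -- Indices start at 0, so the condition concerns every edge but the first.
    step     : ∀ i → 0 < toℕ i →
               ∃[ v ] ∃[ s ] v ∈ e i × s Fin.< i ×
                             (∀ j → j Fin.< i → v ∉ e j) ×
                             (e i - v) ⊆ e s

record IsTightTree {r n} (T : RGraph r n) : Set where
  field
    ordering      : List (Subset n)
    ordering-↭    : ordering ↭ edges T
    tightOrdering : TightOrdering ordering
    -- The vertex set is the union of the edges.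
    covered       : ∀ v → ∃[ e ] e Membership.∈ edges T × v ∈ e

image : ∀ {k n} → (Fin k → Fin n) → Subset k → Subset n
image f p = tabulate λ y → does (Fin.any? λ x → (x ∈? p) ×-dec (f x Fin.≟ y))

MapsEdges : ∀ {r n k} → RGraph r n → RGraph r k → (Fin k → Fin n) → Set
MapsEdges G H f = All (λ e → image f e Membership.∈ edges G) (edges H)

Contains : ∀ {r n k} → RGraph r n → RGraph r k → Set
Contains {n = n} {k} G H =
  ∃[ f ] Injective {A = Fin k} {B = Fin n} _≡_ _≡_ f × MapsEdges G H f

Attainable : ∀ {r k} → ℕ → RGraph r k → ℕ → Set
Attainable {r} n H m = ∃[ G ] size {r} {n} G ≡ m × ¬ Contains G H

_≟ˢ_ : ∀ {n} → DecidableEquality (Subset n)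
_≟ˢ_ = Vec.≡-dec Bool._≟_

image-cong : ∀ {k n} {f g : Fin k → Fin n} → f ≗ g → image f ≗ image g
image-cong {f = f} {g} f≗g p = Vec.tabulate-cong λ y →
  agree y (Fin.any? _) (Fin.any? _)
  where
  agree : ∀ y (d : Dec (∃[ x ] x ∈ p × f x ≡ y)) (d′ : Dec (∃[ x ] x ∈ p × g x ≡ y)) →
          does d ≡ does d′
  agree y (yes _) (yes _) = refl
  agree y (no  _) (no  _) = refl
  agree y (yes (x , x∈p , eq)) (no ¬q) = contradiction (x , x∈p , trans (sym (f≗g x)) eq) ¬q
  agree y (no ¬q) (yes (x , x∈p , eq)) = contradiction (x , x∈p , trans (f≗g x) eq) ¬q

injective? : ∀ {k n} (f : Fin k → Fin n) → Dec (Injective _≡_ _≡_ f)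
injective? f = map′ (λ h eq → h _ _ eq) (λ inj _ _ eq → inj eq)
  (Fin.all? λ i → Fin.all? λ j → (f i Fin.≟ f j) →-dec (i Fin.≟ j))

contains? : ∀ {r n k} (G : RGraph r n) (H : RGraph r k) → Dec (Contains G H)
contains? {n = n} {k} G H = map′ to from (Fin.any? good?)
  where
  Good : (Fin k → Fin n) → Set
  Good f = Injective _≡_ _≡_ f × MapsEdges G H f

  good? : (i : Fin (n ^ k)) → Dec (Good (finToFun i))
  good? i = injective? (finToFun i) ×-dec
            All.all? (λ e → DecMembership._∈?_ _≟ˢ_ (image (finToFun i) e) (edges G)) (edges H)

  to : ∃ (Good ∘ finToFun) → Contains G H
  to (i , good) = finToFun i , good

  from : Contains G H → ∃ (Good ∘ finToFun)
  from (f , inj , maps) = funToFin f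
    , (λ {x} {y} eq → inj (trans (sym (f≗ x)) (trans eq (f≗ y))))
    , All.map (λ {e} → subst (Membership._∈ edges G) (sym (image-cong f≗ e))) maps
    where
    f≗ : finToFun (funToFin f) ≗ f
    f≗ = Fin.finToFun-funToFin f

anyList? : ∀ {n} m {P : Pred (List (Subset n)) 0ℓ} → Decidable P →
           Dec (∃[ es ] length es ≡ m × P es)
anyList? zero P? = map′ (λ p → [] , refl , p) (λ { ([] , refl , p) → p }) (P? [])
anyList? (suc m) P? = map′
  (λ (e , es , eq , p) → e ∷ es , cong suc eq , p)
  (λ { (e ∷ es , eq , p) → e , es , ℕ.suc-injective eq , p })
  (anySubset? λ e → anyList? m (P? ∘ (e ∷_)))

attainable? : ∀ {r k} n (H : RGraph r k) → Decidable (Attainable n H)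
attainable? {r} n H m = map′
  (λ (es , eq , u , f , h) → record { edges = es ; unique = u ; uniform = f } , eq , h)
  (λ (G , eq , h) → edges G , eq , unique G , uniform G , h)
  (anyList? m good?)
  where
  good? : (es : List (Subset n)) →
          Dec (∃[ u ] ∃[ f ] ¬ Contains (record { edges = es ; unique = u ; uniform = f }) H)
  good? es with DecUnique.unique? _≟ˢ_ es | All.all? (λ e → ∣ e ∣ ℕ.≟ r) es
  ... | no ¬u | _     = no λ (u , _) → ¬u u
  ... | yes u | no ¬f = no λ (_ , f , _) → ¬f f
  ... | yes u | yes f = map′ (λ h → u , f , h) (λ (_ , _ , h) → h)
    (¬? (contains? (record { edges = es ; unique = u ; uniform = f }) H))

-- The largest m ≤ b satisfying P, and 0 if there is none.
largest : ∀ {P : Pred ℕ 0ℓ} → Decidable P → ℕ → ℕ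
largest P? zero    = zero
largest P? (suc b) = if does (P? (suc b)) then suc b else largest P? b

-- ex n H is ex_r(n, H).  The search may start at 2 ^ n because no hypergraph on
-- n vertices has more edges; ex-attained and ex-maximal show that the result
-- is the largest attainable number of edges.
ex : ∀ {r k} → ℕ → RGraph r k → ℕ
ex n H = largest (attainable? n H) (2 ^ n)

largest-satisfies : ∀ {P : Pred ℕ 0ℓ} (P? : Decidable P) b → P 0 → P (largest P? b)
largest-satisfies P? zero    p₀ = p₀
largest-satisfies P? (suc b) p₀ with P? (suc b)
... | yes p = p
... | no  _ = largest-satisfies P? b p₀

largest-maximal : ∀ {P : Pred ℕ 0ℓ} (P? : Decidable P) b {m} → m ≤ b → P m → m ≤ largest P? b
largest-maximal P? zero    m≤b p = m≤b
largest-maximal P? (suc b) m≤b p with P? (suc b)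
... | yes _ = m≤b
... | no ¬p with ℕ.m≤n⇒m<n∨m≡n m≤b
...   | inj₁ m<1+b = largest-maximal P? b (s≤s⁻¹ m<1+b) p
...   | inj₂ refl  = contradiction p ¬p

size≤2^n : ∀ {r n} (G : RGraph r n) → size G ≤ 2 ^ n
size≤2^n {n = n} G =
  Fin.injective⇒≤ {f = code ∘ List.lookup (edges G)}
    (λ eq → lookup-injective (unique G) _ _ (code-injective _ _ eq))
  where
  code : ∀ {n} → Subset n → Fin (2 ^ n)
  code []      = zero
  code (b ∷ p) = combine {2} (if b then suc zero else zero) (code p)

  code-injective : ∀ {n} (p q : Subset n) → code p ≡ code q → p ≡ q
  code-injective []      []      _  = refl
  code-injective (a ∷ p) (b ∷ q) eq
    with Fin.combine-injective {2} (if a then suc zero else zero) (code p)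
                                   (if b then suc zero else zero) (code q) eq
  code-injective (true  ∷ p) (true  ∷ q) _ | _ , eq = cong (true ∷_) (code-injective p q eq)
  code-injective (false ∷ p) (false ∷ q) _ | _ , eq = cong (false ∷_) (code-injective p q eq)
  code-injective (true  ∷ p) (false ∷ q) _ | () , _
  code-injective (false ∷ p) (true  ∷ q) _ | () , _

  lookup-injective : ∀ {es : List (Subset n)} → Unique es →
                     ∀ i j → List.lookup es i ≡ List.lookup es j → i ≡ j
  lookup-injective (_  AllPairs.∷ _) zero    zero    _  = refl
  lookup-injective (e≢ AllPairs.∷ _) zero    (suc j) eq =
    contradiction eq (All.lookup e≢ (∈-lookup j))
  lookup-injective (e≢ AllPairs.∷ _) (suc i) zero    eq =
    contradiction (sym eq) (All.lookup e≢ (∈-lookup i))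
  lookup-injective (_  AllPairs.∷ u) (suc i) (suc j) eq = cong suc (lookup-injective u i j eq)

ex-attained : ∀ {r k} n (H : RGraph r k) → 0 < size H → Attainable n H (ex n H)
ex-attained {r} n H 0<H = largest-satisfies (attainable? n H) (2 ^ n)
  (empty , refl , λ (_ , _ , maps) → absurd (edges H) 0<H maps)
  where
  empty : RGraph r n
  empty = record { edges = [] ; unique = AllPairs.[] ; uniform = [] }

  absurd : ∀ es → 0 < length es → ∀ {g : Subset _ → Subset n} → ¬ All (λ e → g e Membership.∈ []) es
  absurd (_ ∷ _) _ (() ∷ _)

ex-maximal : ∀ {r k} n (H : RGraph r k) (G : RGraph r n) → ¬ Contains G H → size G ≤ ex n H
ex-maximal n H G free = largest-maximal (attainable? n H) (2 ^ n) (size≤2^n G) (G , refl , free)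

{-# OPTIONS --safe #-}
module Submission where

-- Let D be a set of vertices common to all edges of T.  Counting ordered edges and
-- ordered sets of the shadow, the bound for G follows from the bound (with the shadow
-- of G in place of all (r-1)-sets) for T and G replaced by their links at D: if G is
-- denser than the bound, then so is its link at some set of the size of D, by
-- averaging over one vertex after the other.  Taking D maximal leaves for T, when
-- t ≤ 4, only stars of single vertices, the paths with three and four edges, the
-- spider with degrees 2 and 3, and two trees on six vertices: a triple with one
-- further triple on each of its pairs, and the tight path.
--
-- If every edge of a graph (triple system) is split into the weights 1/d of its
-- vertices (pairs) of degree d, some edge is light, so that its vertices (pairs) have
-- degrees large enough to attach the leaves greedily.  This gives all trees with a
-- central edge.  The two paths with four edges are found by discharging: elements of
-- degree 1 and 2 give to adjacent elements of degree at least 4, and an element whose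
-- degree still exceeds 3 afterwards lies in the middle of the path.

open import Defs
import Algebra.Properties.Semiring.Sum as SemiringSum
open import Data.Bool.Base using (true; false; if_then_else_)
open import Data.Fin.Base as Fin using (Fin; zero; suc)
open import Data.Fin.Patterns using (0F; 1F; 2F; 3F; 4F; 5F)
import Data.Fin.Properties as Fin
open import Data.Fin.Subset using (Subset; ⊥; ⁅_⁆; _∈_; _∉_; _⊆_; _∪_; _-_; ∣_∣)
open import Data.Fin.Subset.Properties using
  ( _∈?_; ∉⊥; ∣⊥∣≡0; Empty-unique; nonempty?; x∈⁅x⁆; x∈⁅y⁆⇒x≡y; x∈p∪q⁺; x∈p∪q⁻; ∪-comm; ∪-assoc; ∪-identityʳ
  ; ⊆-antisym; p⊂q⇒∣p∣<∣q∣; p─q⊆p; x∈p∧x≢y⇒x∈p-y )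
open import Data.Integer.Base as ℤ using (+_; 1ℤ)
import Data.Integer.Properties as ℤ
open import Data.List.Base as List using (List; []; _∷_; length)
import Data.List.Membership.DecPropositional as DecMembership
open import Data.List.Membership.Propositional using () renaming (_∈_ to _∈ˡ_)
open import Data.List.Membership.Propositional.Properties using (∈-map⁻; ∈-lookup)
open import Data.List.Relation.Binary.Permutation.Propositional using (↭-sym)
open import Data.List.Relation.Binary.Permutation.Propositional.Properties using (↭-length; ∈-resp-↭; All-resp-↭)
open import Data.List.Relation.Unary.All as All using (All; []; _∷_)
open import Data.List.Relation.Unary.All.Properties using (map⁺; ¬Any⇒All¬)
open import Data.List.Relation.Unary.AllPairs using ([]; _∷_)
open import Data.List.Relation.Unary.Any using (here; there)
open import Data.List.Relation.Unary.Unique.Propositional using () renaming (Unique to Uniqueˡ)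
open import Data.Nat.Base as ℕ using (ℕ; zero; suc; pred; _+_; _*_; _∸_; _!; _≤_; _<_; z≤n; s≤s; NonZero)
open import Data.Nat.Combinatorics using (_C_; nCk≡nPk/k!; nPk≡n!/[n∸k]!)
open import Data.Nat.Combinatorics.Base using (_P′_)
open import Data.Nat.Combinatorics.Specification using (nP′k≡n[n∸1P′k∸1]; nP′k≡n!/[n∸k]!; k!∣nP′k)
open import Data.Nat.DivMod using (m/n*n≡m)
import Data.Nat.Properties as ℕ
open import Data.Nat.Solver using (module +-*-Solver)
open import Data.Product.Base using (Σ; ∃-syntax; _×_; _,_; proj₁; proj₂)
open import Data.Rational.Base as ℚ using (_/_)
import Data.Rational.Properties as ℚ
import Data.Rational.Unnormalised.Base as ℚᵘ
import Data.Rational.Unnormalised.Properties as ℚᵘ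
open import Data.Sum.Base using (_⊎_; [_,_]′; inj₁; inj₂)
open import Data.Vec.Base as Vec using (Vec; []; _∷_; here; there)
open import Data.Vec.Functional using (updateAt)
open import Data.Vec.Functional.Properties using (updateAt-updates; updateAt-minimal)
import Data.Vec.Properties as Vec
open import Data.Vec.Relation.Unary.All as VecAll using ([]; _∷_)
import Data.Vec.Relation.Unary.All.Properties as VecAllₚ
open import Data.Vec.Relation.Unary.AllPairs using ([]; _∷_; allPairs?)
open import Data.Vec.Relation.Unary.Unique.Propositional using (Unique)
import Data.Vec.Relation.Unary.Unique.Propositional.Properties as Unique
open import Function.Base using (_∘_; const; case_of_)
open import Level using (Level; 0ℓ)
open import Relation.Binary.Core using (Rel)
open import Relation.Binary.Definitions using (Symmetric) renaming (Decidable to Decidable₂)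
open import Relation.Binary.PropositionalEquality
open import Relation.Nullary.Decidable
  using (Dec; yes; no; does; dec-true; _×-dec_; ¬?; from-no; True; toWitness)
open import Relation.Nullary.Negation using (¬_; contradiction)
open import Relation.Unary using (Pred; Decidable)

private
  module Sum = SemiringSum ℕ.+-*-semiring

private variable
  k n s t : ℕ
  ℓ ℓ′ : Level

_∈ᶠ?_ : (x : Fin n) (xs : List (Fin n)) → Dec (x ∈ˡ xs)
_∈ᶠ?_ = DecMembership._∈?_ Fin._≟_

_∈ˢ?_ : (e : Subset n) (E : List (Subset n)) → Dec (e ∈ˡ E)
_∈ˢ?_ = DecMembership._∈?_ _≟ˢ_

-- Finite sums and counting

opaque

  ∑ : (Fin n → ℕ) → ℕ
  ∑ = Sum.sum

  ∑-cong : {f g : Fin n → ℕ} → (∀ i → f i ≡ g i) → ∑ f ≡ ∑ g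
  ∑-cong {n} = Sum.sum-cong-≗ {n}

  ∑-zero : ∀ n → ∑ {n} (λ _ → 0) ≡ 0
  ∑-zero = Sum.sum-replicate-zero

  ∑-suc : ∀ (f : Fin (suc n) → ℕ) → ∑ f ≡ f zero + ∑ (f ∘ suc)
  ∑-suc f = refl

  ∑-+ : ∀ (f g : Fin n → ℕ) → ∑ (λ i → f i + g i) ≡ ∑ f + ∑ g
  ∑-+ {n} = Sum.∑-distrib-+ {n}

  *-distribˡ-∑ : ∀ c (f : Fin n → ℕ) → c * ∑ f ≡ ∑ (λ i → c * f i)
  *-distribˡ-∑ {n} c f = Sum.*-distribˡ-sum {n} c f

  *-distribʳ-∑ : ∀ c (f : Fin n → ℕ) → ∑ f * c ≡ ∑ (λ i → f i * c)
  *-distribʳ-∑ {n} c f = Sum.*-distribʳ-sum {n} c f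

  ∑-swap : ∀ {m n} (f : Fin m → Fin n → ℕ) → ∑ (λ i → ∑ (f i)) ≡ ∑ (λ j → ∑ (λ i → f i j))
  ∑-swap {m} {n} = Sum.∑-comm {m} {n}

  ∑-mono : {f g : Fin n → ℕ} → (∀ i → f i ≤ g i) → ∑ f ≤ ∑ g
  ∑-mono {zero}  f≤g = z≤n
  ∑-mono {suc n} f≤g = ℕ.+-mono-≤ (f≤g zero) (∑-mono (f≤g ∘ suc))

infixl 10 ∑-syntax
∑-syntax : ∀ n → (Fin n → ℕ) → ℕ
∑-syntax _ = ∑
syntax ∑-syntax n (λ i → e) = ∑[ i < n ] e

∑-<⇒∃< : (f g : Fin n → ℕ) → ∑ f < ∑ g → ∃[ i ] f i < g i
∑-<⇒∃< f g sf<sg with Fin.any? (λ i → f i ℕ.<? g i)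
... | yes found = found
... | no  none  = contradiction sf<sg (ℕ.≤⇒≯ (∑-mono λ i → ℕ.≮⇒≥ λ f<g → none (i , f<g)))

⟦_⟧ : {P : Set ℓ} → Dec P → ℕ
⟦ p ⟧ = if does p then 1 else 0

module _ {P : Set ℓ} where

  ⟦⟧≤1 : (p : Dec P) → ⟦ p ⟧ ≤ 1
  ⟦⟧≤1 (yes _) = ℕ.≤-refl
  ⟦⟧≤1 (no  _) = z≤n

  ⟦⟧-true : (p : Dec P) → P → ⟦ p ⟧ ≡ 1
  ⟦⟧-true (yes _)  _ = refl
  ⟦⟧-true (no ¬p) p = contradiction p ¬p

  ⟦⟧-false : (p : Dec P) → ¬ P → ⟦ p ⟧ ≡ 0
  ⟦⟧-false (yes p) ¬p = contradiction p ¬p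
  ⟦⟧-false (no _)  _  = refl

⟦⟧-mono : {P : Set ℓ} {Q : Set ℓ′} (p : Dec P) (q : Dec Q) → (P → Q) → ⟦ p ⟧ ≤ ⟦ q ⟧
⟦⟧-mono (no _)  _ _   = z≤n
⟦⟧-mono (yes p) q p⇒q = ℕ.≤-reflexive (sym (⟦⟧-true q (p⇒q p)))

⟦⟧-cong : {P : Set ℓ} {Q : Set ℓ′} (p : Dec P) (q : Dec Q) → (P → Q) → (Q → P) → ⟦ p ⟧ ≡ ⟦ q ⟧
⟦⟧-cong p q p⇒q q⇒p = ℕ.≤-antisym (⟦⟧-mono p q p⇒q) (⟦⟧-mono q p q⇒p)

⟦⟧-⊎ : {P Q R : Set ℓ} (p : Dec P) (q : Dec Q) (r : Dec R) → (P → Q ⊎ R) → ⟦ p ⟧ ≤ ⟦ q ⟧ + ⟦ r ⟧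
⟦⟧-⊎ (no _)  _ _ _ = z≤n
⟦⟧-⊎ (yes p) q r f with f p
... | inj₁ q′ = ℕ.≤-trans (ℕ.≤-reflexive (sym (⟦⟧-true q q′))) (ℕ.m≤m+n _ _)
... | inj₂ r′ = ℕ.≤-trans (ℕ.≤-reflexive (sym (⟦⟧-true r r′))) (ℕ.m≤n+m _ _)

count : {P : Pred (Fin n) ℓ} → Decidable P → ℕ
count P? = ∑ λ x → ⟦ P? x ⟧

count-≟ : (y : Fin n) → count (λ x → x Fin.≟ y) ≡ 1
count-≟ {suc n} zero    = trans (∑-suc (λ x → ⟦ x Fin.≟ zero ⟧))
  (cong suc (trans (∑-cong λ x → ⟦⟧-false (suc x Fin.≟ zero) λ ()) (∑-zero n)))
count-≟ {suc n} (suc y) = trans (∑-suc (λ x → ⟦ x Fin.≟ suc y ⟧)) (trans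
  (∑-cong λ x → ⟦⟧-cong (suc x Fin.≟ suc y) (x Fin.≟ y) Fin.suc-injective (cong suc))
  (count-≟ y))

module _ {P : Pred (Fin n) ℓ} (P? : Decidable P) where

  module _ {Q : Pred (Fin n) ℓ′} (Q? : Decidable Q) where

    count-mono : (∀ {x} → P x → Q x) → count P? ≤ count Q?
    count-mono P⇒Q = ∑-mono λ x → ⟦⟧-mono (P? x) (Q? x) P⇒Q

  count-empty : (∀ x → ¬ P x) → count P? ≡ 0
  count-empty ¬P = trans (∑-cong λ x → ⟦⟧-false (P? x) (¬P x)) (∑-zero n)

  count-∈ : ∀ {x} → P x → 0 < count P?
  count-∈ {x} px = ℕ.≤-trans (ℕ.≤-reflexive (sym (count-≟ x)))
    (∑-mono λ y → ⟦⟧-mono (y Fin.≟ x) (P? y) λ { refl → px })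

  count-cover : ∀ xs → (∀ {x} → P x → x ∈ˡ xs) → count P? ≤ length xs
  count-cover xs cover = ℕ.≤-trans (∑-mono λ x → ⟦⟧-mono (P? x) (x ∈ᶠ? xs) cover) (count-∈ᶠ? xs)
    where
    count-∈ᶠ? : ∀ xs → count (λ x → x ∈ᶠ? xs) ≤ length xs
    count-∈ᶠ? []       = ℕ.≤-reflexive (∑-zero n)
    count-∈ᶠ? (y ∷ ys) = begin
      count (λ x → x ∈ᶠ? (y ∷ ys))                       ≤⟨ ∑-mono split ⟩
      ∑ (λ x → ⟦ x Fin.≟ y ⟧ + ⟦ x ∈ᶠ? ys ⟧)           ≡⟨ ∑-+ (λ x → ⟦ x Fin.≟ y ⟧) _ ⟩
      count (λ x → x Fin.≟ y) + count (λ x → x ∈ᶠ? ys)   ≤⟨ ℕ.+-mono-≤ (ℕ.≤-reflexive (count-≟ y)) (count-∈ᶠ? ys) ⟩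
      suc (length ys)                                   ∎
      where
      open ℕ.≤-Reasoning
      split : ∀ x → ⟦ x ∈ᶠ? (y ∷ ys) ⟧ ≤ ⟦ x Fin.≟ y ⟧ + ⟦ x ∈ᶠ? ys ⟧
      split x = ⟦⟧-⊎ (x ∈ᶠ? (y ∷ ys)) (x Fin.≟ y) (x ∈ᶠ? ys) λ { (here p) → inj₁ p ; (there p) → inj₂ p }

  -- When the greedy choice of `pick` fails, the second case still yields information: all elements
  -- with P lie in `xs`. The path arguments after discharging exploit it.
  avoid? : ∀ xs → (∃[ x ] P x × All (x ≢_) xs) ⊎ (∀ {x} → P x → x ∈ˡ xs)
  avoid? xs with Fin.any? (λ x → P? x ×-dec ¬? (x ∈ᶠ? xs))
  ... | yes (x , px , x∉xs) = inj₁ (x , px , ¬Any⇒All¬ xs x∉xs)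
  ... | no  none = inj₂ λ {x} px → case x ∈ᶠ? xs of λ
      { (yes x∈xs) → x∈xs ; (no x∉xs) → contradiction (x , px , x∉xs) none }

  pick : ∀ xs → length xs < count P? → ∃[ x ] P x × All (x ≢_) xs
  pick xs xs<P with avoid? xs
  ... | inj₁ found = found
  ... | inj₂ cover = contradiction xs<P (ℕ.≤⇒≯ (count-cover xs cover))

  distinct : ∀ k → k ≤ count P? → Σ (Vec (Fin n) k) λ xs → Unique xs × VecAll.All P xs
  distinct zero    _   = [] , [] , []
  distinct (suc k) k<P =
    let xs , uxs , pxs  = distinct k (ℕ.<⇒≤ k<P)
        x , px , x≢xs   = pick (Vec.toList xs) (subst (_< count P?) (sym (Vec.length-toList xs)) k<P)
    in  x ∷ xs , VecAllₚ.toList⁻ x≢xs ∷ uxs , px ∷ pxs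

-- Graphs

-- Summed over degrees, this counts the non-isolated vertices of a graph, or the ordered pairs in
-- the shadow of a triple system.
positive : ℕ → ℕ
positive d = ⟦ 0 ℕ.<? d ⟧

-- 6/d, rounded down to 0 from d = 4 on.
φ : ℕ → ℕ
φ 1 = 6
φ 2 = 3
φ 3 = 2
φ _ = 0

-- A vertex of degree d spends weight at most 6 on all its edges together.
d*φ≤6 : ∀ d → d * φ d ≤ 6 * positive d
d*φ≤6 0 = z≤n
d*φ≤6 1 = ℕ.≤-refl
d*φ≤6 2 = ℕ.≤-refl
d*φ≤6 3 = ℕ.≤-refl
d*φ≤6 (suc (suc (suc (suc d)))) = ℕ.≤-trans (ℕ.≤-reflexive (ℕ.*-zeroʳ d)) z≤n

-- Degree 1 alone has weight 6, and two degrees 2 weigh 3 + 3.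
light₂ : ∀ d e → 0 < d → 0 < e → φ d + φ e < 6 → 2 ≤ d × 2 ≤ e × (3 ≤ d ⊎ 3 ≤ e)
light₂ 1 e _ _ lt = contradiction lt (ℕ.m+n≮m 6 (φ e))
light₂ 2 1 _ _ lt = contradiction lt (from-no (9 ℕ.<? 6))
light₂ 2 2 _ _ lt = contradiction lt (from-no (6 ℕ.<? 6))
light₂ 2 (suc (suc (suc e))) _ _ _ = s≤s (s≤s z≤n) , s≤s (s≤s z≤n) , inj₂ (s≤s (s≤s (s≤s z≤n)))
light₂ d@(suc (suc (suc _))) 1 _ _ lt = contradiction lt (ℕ.m+n≮n (φ d) 6)
light₂ (suc (suc (suc _))) (suc (suc e)) _ _ _ = s≤s (s≤s z≤n) , s≤s (s≤s z≤n) , inj₁ (s≤s (s≤s (s≤s z≤n)))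

-- Degrees 2 and 3 weigh at least 2 each, so two of them reach 4; degree 1 weighs 6 alone.
light₃ : ∀ d e → 0 < d → 0 < e → φ d + φ e < 4 → 2 ≤ d × 2 ≤ e × (4 ≤ d ⊎ 4 ≤ e)
light₃ 1 e _ _ lt = contradiction (ℕ.≤-trans lt (ℕ.m≤m+n 4 2)) (ℕ.m+n≮m 6 (φ e))
light₃ d 1 _ _ lt = contradiction (ℕ.≤-trans lt (ℕ.m≤m+n 4 2)) (ℕ.m+n≮n (φ d) 6)
light₃ 2 2 _ _ lt = contradiction lt (from-no (6 ℕ.<? 4))
light₃ 2 3 _ _ lt = contradiction lt (from-no (5 ℕ.<? 4))
light₃ 3 2 _ _ lt = contradiction lt (from-no (5 ℕ.<? 4))
light₃ 3 3 _ _ lt = contradiction lt (from-no (4 ℕ.<? 4))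
light₃ (suc (suc d)) (suc (suc (suc (suc _)))) _ _ _ = s≤s (s≤s z≤n) , s≤s (s≤s z≤n) , inj₂ (ℕ.m≤m+n 4 _)
light₃ (suc (suc (suc (suc _)))) (suc (suc _)) _ _ _ = s≤s (s≤s z≤n) , s≤s (s≤s z≤n) , inj₁ (ℕ.m≤m+n 4 _)

sum-weighted : ∀ {n} c {d e : Fin n → ℕ} (w : Fin n → ℕ) → (∀ i → d i * w i ≤ c * e i) →
               ∑ (λ i → d i * w i) ≤ c * ∑ e
sum-weighted c {e = e} w le = ℕ.≤-trans (∑-mono le) (ℕ.≤-reflexive (sym (*-distribˡ-∑ c e)))

module Graph {n} {A : Rel (Fin n) 0ℓ} (A? : Decidable₂ A) (A-sym : Symmetric A) (A-irrefl : ∀ {x} → ¬ A x x) where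

  deg : Fin n → ℕ
  deg x = count (A? x)

  A⇒≢ : ∀ {x y} → A x y → x ≢ y
  A⇒≢ axy refl = A-irrefl axy

  A?-sym : ∀ x y → ⟦ A? x y ⟧ ≡ ⟦ A? y x ⟧
  A?-sym x y = ⟦⟧-cong (A? x y) (A? y x) A-sym A-sym

  -- Distributing φ (deg x) over the edges at x puts weight φ (deg x) + φ (deg y)
  -- on the edge x y.
  light-edge : ∀ m → m * ∑ (positive ∘ deg) < ∑ deg →
               ∃[ x ] ∃[ y ] A x y × m * (φ (deg x) + φ (deg y)) < 12
  light-edge m large =
    let x , lx = ∑-<⇒∃< (λ x → ∑[ y < n ] (m * weight x y)) (λ x → ∑[ y < n ] (12 * ⟦ A? x y ⟧)) total
        y , ly = ∑-<⇒∃< (λ y → m * weight x y) (λ y → 12 * ⟦ A? x y ⟧) lx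
    in  x , y , extract x y (A? x y) ly
    where
    weight : Fin n → Fin n → ℕ
    weight x y = ⟦ A? x y ⟧ * φ (deg x) + ⟦ A? x y ⟧ * φ (deg y)

    half : ℕ
    half = ∑[ x < n ] (deg x * φ (deg x))

    left : ∑[ x < n ] ∑[ y < n ] (⟦ A? x y ⟧ * φ (deg x)) ≡ half
    left = ∑-cong λ x → sym (*-distribʳ-∑ (φ (deg x)) (λ y → ⟦ A? x y ⟧))

    right : ∑[ x < n ] ∑[ y < n ] (⟦ A? x y ⟧ * φ (deg y)) ≡ half
    right = trans (∑-swap _) (trans
      (∑-cong λ y → ∑-cong λ x → cong (_* φ (deg y)) (A?-sym x y)) left)

    total : ∑[ x < n ] ∑[ y < n ] (m * weight x y) < ∑[ x < n ] ∑[ y < n ] (12 * ⟦ A? x y ⟧)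
    total = begin-strict
      ∑[ x < n ] ∑[ y < n ] (m * weight x y)     ≡⟨ ∑-cong (λ x → *-distribˡ-∑ m (weight x)) ⟨
      ∑[ x < n ] (m * ∑[ y < n ] weight x y)     ≡⟨ *-distribˡ-∑ {n} m (λ x → ∑ (weight x)) ⟨
      m * ∑[ x < n ] ∑[ y < n ] weight x y       ≡⟨ cong (m *_) (∑-cong λ x → ∑-+ (λ y → ⟦ A? x y ⟧ * φ (deg x)) _) ⟩
      m * ∑[ x < n ] (∑[ y < n ] (⟦ A? x y ⟧ * φ (deg x)) + ∑[ y < n ] (⟦ A? x y ⟧ * φ (deg y)))
        ≡⟨ cong (m *_) (∑-+ (λ x → ∑[ y < n ] (⟦ A? x y ⟧ * φ (deg x))) _) ⟩
      m * (∑[ x < n ] ∑[ y < n ] (⟦ A? x y ⟧ * φ (deg x)) + ∑[ x < n ] ∑[ y < n ] (⟦ A? x y ⟧ * φ (deg y)))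
        ≡⟨ cong (m *_) (cong₂ _+_ left right) ⟩
      -- Each half is at most 6 per non-isolated vertex; this is the origin of the 12.
      m * (half + half)                          ≤⟨ ℕ.*-monoʳ-≤ m (ℕ.+-mono-≤ half≤ half≤) ⟩
      m * (6 * V + 6 * V)                        ≡⟨ solve 2 (λ m v → m :* (con 6 :* v :+ con 6 :* v) := con 12 :* (m :* v)) refl m V ⟩
      12 * (m * V)                               <⟨ ℕ.*-monoʳ-< 12 large ⟩
      12 * ∑ deg                               ≡⟨ *-distribˡ-∑ 12 deg ⟩
      ∑[ x < n ] (12 * deg x)                    ≡⟨ ∑-cong (λ x → *-distribˡ-∑ 12 (λ y → ⟦ A? x y ⟧)) ⟩
      ∑[ x < n ] ∑[ y < n ] (12 * ⟦ A? x y ⟧)    ∎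
      where
      open ℕ.≤-Reasoning
      open +-*-Solver using (solve; _:*_; _:+_; con; _:=_)
      V = ∑ (positive ∘ deg)
      half≤ : half ≤ 6 * V
      half≤ = sum-weighted 6 {deg} (φ ∘ deg) (d*φ≤6 ∘ deg)

    extract : ∀ x y (a : Dec (A x y)) → m * (⟦ a ⟧ * φ (deg x) + ⟦ a ⟧ * φ (deg y)) < 12 * ⟦ a ⟧ →
              A x y × m * (φ (deg x) + φ (deg y)) < 12
    extract x y (yes a) lt = a , subst (λ k → m * k < 12)
      (cong₂ _+_ (ℕ.*-identityˡ (φ (deg x))) (ℕ.*-identityˡ (φ (deg y)))) lt
    -- Off the edges the right-hand side is 0, so the strict inequality is impossible.
    extract x y (no _)  lt = contradiction lt λ ()

  Path₃ Spider Path₄ : Set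
  Path₃  = ∃[ a ] ∃[ x ] ∃[ y ] ∃[ b ] Unique (a ∷ x ∷ y ∷ b ∷ []) × A a x × A x y × A y b
  Spider = ∃[ a ] ∃[ x ] ∃[ y ] ∃[ b ] ∃[ c ] Unique (a ∷ x ∷ y ∷ b ∷ c ∷ []) × A a x × A x y × A y b × A y c
  Path₄  = ∃[ a ] ∃[ x ] ∃[ p ] ∃[ y ] ∃[ b ] Unique (a ∷ x ∷ p ∷ y ∷ b ∷ []) × A a x × A x p × A p y × A y b

  path₃ : 2 * ∑ (positive ∘ deg) < ∑ deg → Path₃
  path₃ large =
    let x , y , xy , lt = light-edge 2 large
        2≤x , 2≤y , bigger = light₂ (deg x) (deg y) (count-∈ (A? x) xy) (count-∈ (A? y) (A-sym xy)) (ℕ.*-cancelˡ-< 2 _ 6 lt)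
    in  [ (λ 3≤x → extend x y xy 3≤x 2≤y) , (λ 3≤y → extend y x (A-sym xy) 3≤y 2≤x) ]′ bigger
    where
    extend : ∀ x y → A x y → 3 ≤ deg x → 2 ≤ deg y → Path₃
    -- The end with the smaller degree bound chooses its leaf first; the other end then has two
    -- vertices to avoid, hence degree 3.
    extend x y xy 3≤x 2≤y with pick (A? y) (x ∷ []) 2≤y
    ... | b , yb , b≢x ∷ [] with pick (A? x) (y ∷ b ∷ []) 3≤x
    ...   | a , xa , a≢y ∷ a≢b ∷ [] =
      a , x , y , b
      , (≢-sym (A⇒≢ xa) ∷ a≢y ∷ a≢b ∷ []) ∷ (A⇒≢ xy ∷ ≢-sym b≢x ∷ []) ∷ (A⇒≢ yb ∷ []) ∷ [] ∷ []
      , A-sym xa , xy , yb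


  spider : 3 * ∑ (positive ∘ deg) < ∑ deg → Spider
  spider large =
    let x , y , xy , lt = light-edge 3 large
        2≤x , 2≤y , bigger = light₃ (deg x) (deg y) (count-∈ (A? x) xy) (count-∈ (A? y) (A-sym xy)) (ℕ.*-cancelˡ-< 3 _ 4 lt)
    in  [ (λ 4≤x → extend y x (A-sym xy) 2≤y 4≤x) , (λ 4≤y → extend x y xy 2≤x 4≤y) ]′ bigger
    where
    extend : ∀ x y → A x y → 2 ≤ deg x → 4 ≤ deg y → Spider
    -- The second leaf at y avoids a, x and the first leaf b, which uses degree 4.
    extend x y xy 2≤x 4≤y with pick (A? x) (y ∷ []) 2≤x
    ... | a , xa , a≢y ∷ [] with pick (A? y) (a ∷ x ∷ []) (ℕ.<⇒≤ 4≤y)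
    ...   | b , yb , b≢a ∷ b≢x ∷ [] with pick (A? y) (a ∷ x ∷ b ∷ []) 4≤y
    ...     | c , yc , c≢a ∷ c≢x ∷ c≢b ∷ [] =
      a , x , y , b , c
      , (≢-sym (A⇒≢ xa) ∷ a≢y ∷ ≢-sym b≢a ∷ ≢-sym c≢a ∷ []) ∷ (A⇒≢ xy ∷ ≢-sym b≢x ∷ ≢-sym c≢x ∷ [])
        ∷ (A⇒≢ yb ∷ A⇒≢ yc ∷ []) ∷ (≢-sym c≢b ∷ []) ∷ [] ∷ []
      , A-sym xa , xy , yb , yc

  -- Read: y gives one unit to x. What moves is the allowance of 3 units of each non-isolated
  -- vertex, against which its degree is measured.
  gift? : ∀ x y → Dec (A x y × 4 ≤ deg x × deg y ≤ 2)
  gift? x y = A? x y ×-dec (4 ℕ.≤? deg x) ×-dec (deg y ℕ.≤? 2)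

  -- For x of degree at least 4, these are the neighbours that give nothing to x.
  rich? : ∀ x y → Dec (A x y × 3 ≤ deg y)
  rich? x y = A? x y ×-dec (3 ℕ.≤? deg y)

  -- Discharging: each vertex of degree at most 2 gives one unit to each of its
  -- neighbours of degree at least 4.
  surplus : 3 * ∑ (positive ∘ deg) < ∑ deg →
            ∃[ x ] 3 * positive (deg x) + count (gift? x) < deg x + count (λ y → gift? y x)
  surplus large = ∑-<⇒∃< _ _ (begin-strict
    ∑[ x < n ] (3 * positive (deg x) + count (gift? x))
      ≡⟨ ∑-+ (λ x → 3 * positive (deg x)) _ ⟩
    ∑[ x < n ] (3 * positive (deg x)) + ∑[ x < n ] count (gift? x)
      ≡⟨ cong (_+ ∑[ x < n ] count (gift? x)) (*-distribˡ-∑ 3 (positive ∘ deg)) ⟨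
    3 * ∑ (positive ∘ deg) + ∑[ x < n ] count (gift? x)
      <⟨ ℕ.+-monoˡ-< _ large ⟩
    ∑ deg + ∑[ x < n ] ∑[ y < n ] ⟦ gift? x y ⟧
      ≡⟨ cong (_+_ (∑ deg)) (∑-swap (λ x y → ⟦ gift? x y ⟧)) ⟩
    ∑ deg + ∑[ x < n ] ∑[ y < n ] ⟦ gift? y x ⟧
      ≡⟨ ∑-+ deg _ ⟨
    ∑[ x < n ] (deg x + count (λ y → gift? y x)) ∎)
    where open ℕ.≤-Reasoning

  -- The vertex itself is the middle of the path: two neighbours of degree at least 4 allow both
  -- ends to be chosen greedily.
  path₄-low : ∀ x → 2 ≤ count (λ y → gift? y x) → Path₄
  path₄-low p 2≤ with pick (λ y → gift? y p) [] (ℕ.<⇒≤ 2≤)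
  ... | x , (xp , 4≤x , _) , [] with pick (λ y → gift? y p) (x ∷ []) 2≤
  ...   | y , (yp , 4≤y , _) , y≢x ∷ [] with pick (A? x) (p ∷ y ∷ []) (ℕ.<⇒≤ 4≤x)
  ...     | a , xa , a≢p ∷ a≢y ∷ [] with pick (A? y) (a ∷ x ∷ p ∷ []) 4≤y
  ...       | b , yb , b≢a ∷ b≢x ∷ b≢p ∷ [] =
    a , x , p , y , b
    , (≢-sym (A⇒≢ xa) ∷ a≢p ∷ a≢y ∷ ≢-sym b≢a ∷ []) ∷ (A⇒≢ xp ∷ ≢-sym y≢x ∷ ≢-sym b≢x ∷ [])
      ∷ (≢-sym (A⇒≢ yp) ∷ ≢-sym b≢p ∷ []) ∷ (A⇒≢ yb ∷ []) ∷ [] ∷ []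
    , A-sym xa , xp , A-sym yp , yb

  -- Again the vertex p is the middle. If y has no end to offer, its neighbours all lie among a, x,
  -- p. A rich neighbour w of p other than x, y, a is then not adjacent to y, and a path with y, p,
  -- w in the middle exists instead.
  path₄-high : ∀ x → 4 ≤ count (rich? x) → Path₄
  path₄-high p 4≤ with pick (rich? p) [] (ℕ.m+n≤o⇒m≤o 1 4≤)
  ... | x , (px , 3≤x) , [] with pick (rich? p) (x ∷ []) (ℕ.m+n≤o⇒m≤o 2 4≤)
  ...   | y , (py , 3≤y) , y≢x ∷ [] with pick (A? x) (p ∷ y ∷ []) 3≤x
  ...     | a , xa , a≢p ∷ a≢y ∷ [] with avoid? (A? y) (a ∷ x ∷ p ∷ [])
  ...       | inj₁ (b , yb , b≢a ∷ b≢x ∷ b≢p ∷ []) =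
    a , x , p , y , b
    , (≢-sym (A⇒≢ xa) ∷ a≢p ∷ a≢y ∷ ≢-sym b≢a ∷ []) ∷ (≢-sym (A⇒≢ px) ∷ ≢-sym y≢x ∷ ≢-sym b≢x ∷ [])
      ∷ (A⇒≢ py ∷ ≢-sym b≢p ∷ []) ∷ (A⇒≢ yb ∷ []) ∷ [] ∷ []
    , A-sym xa , A-sym px , py , yb
  ...       | inj₂ y-cover with pick (rich? p) (x ∷ y ∷ a ∷ []) 4≤
  ...         | w , (pw , 3≤w) , w≢x ∷ w≢y ∷ w≢a ∷ [] with pick (A? w) (p ∷ y ∷ []) 3≤w
  ...           | b , wb , b≢p ∷ b≢y ∷ [] with pick (A? y) (p ∷ b ∷ []) 3≤y
  ...             | c , yc , c≢p ∷ c≢b ∷ [] =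
    c , y , p , w , b
    , (≢-sym (A⇒≢ yc) ∷ c≢p ∷ c≢w ∷ c≢b ∷ []) ∷ (≢-sym (A⇒≢ py) ∷ ≢-sym w≢y ∷ ≢-sym b≢y ∷ [])
      ∷ (A⇒≢ pw ∷ ≢-sym b≢p ∷ []) ∷ (A⇒≢ wb ∷ []) ∷ [] ∷ []
    , A-sym yc , A-sym py , pw , wb
    where
    c≢w : c ≢ w
    c≢w refl with y-cover yc
    ... | here w≡a                 = w≢a w≡a
    ... | there (here w≡x)         = w≢x w≡x
    ... | there (there (here w≡p)) = A⇒≢ pw (sym w≡p)

  path₄ : 3 * ∑ (positive ∘ deg) < ∑ deg → Path₄
  path₄ large = let x , lt = surplus large in cases x (deg x) refl lt
    where
    received≤deg : ∀ x → count (λ y → gift? y x) ≤ deg x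
    received≤deg x = count-mono (λ y → gift? y x) (A? x) λ (yx , _) → A-sym yx

    cases : ∀ x d → deg x ≡ d → 3 * positive d + count (gift? x) < d + count (λ y → gift? y x) → Path₄
    -- A vertex of degree 0 or 1 has no surplus, as it gives at most one unit per neighbour.
    cases x 0 eq lt = contradiction (ℕ.≤-trans lt (subst (count (λ y → gift? y x) ≤_) eq (received≤deg x))) λ ()
    cases x 1 eq lt = contradiction (ℕ.≤-trans lt (s≤s (subst (count (λ y → gift? y x) ≤_) eq (received≤deg x)))) λ { (s≤s (s≤s ())) }
    -- Degree 2 falls short of the allowance, so the surplus forces at least two units to be given.
    cases x 2 eq (s≤s (s≤s lt)) = path₄-low x (ℕ.m+n≤o⇒m≤o 2 lt)
    -- From degree 3 on nothing is given. The degree exceeds 3 plus the units received, one for each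
    -- neighbour that is not rich, so at least 4 neighbours are rich.
    cases x (suc (suc (suc d))) eq (s≤s (s≤s (s≤s lt))) = path₄-high x (ℕ.+-cancelʳ-≤ (count (gift? x)) 4 _ (begin
      4 + count (gift? x)                  ≤⟨ s≤s (s≤s (s≤s lt)) ⟩
      3 + d + count (λ y → gift? y x)      ≡⟨ cong (_+_ (3 + d)) (count-empty (λ y → gift? y x) not-low) ⟩
      3 + d + 0                            ≡⟨ ℕ.+-identityʳ (3 + d) ⟩
      3 + d                                ≡⟨ eq ⟨
      deg x                                ≤⟨ ∑-mono (λ y → ⟦⟧-⊎ (A? x y) (rich? x y) (gift? x y) (split y)) ⟩
      ∑[ y < n ] (⟦ rich? x y ⟧ + ⟦ gift? x y ⟧)  ≡⟨ ∑-+ (λ y → ⟦ rich? x y ⟧) _ ⟩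
      count (rich? x) + count (gift? x)    ∎))
      where
      open ℕ.≤-Reasoning
      not-low : ∀ y → ¬ (A y x × 4 ≤ deg y × deg x ≤ 2)
      not-low y (_ , _ , x≤2) with subst (_≤ 2) eq x≤2
      ... | s≤s (s≤s ())
      4≤x : 4 ≤ deg x
      4≤x = subst (4 ≤_) (sym eq) (s≤s (s≤s (s≤s (ℕ.≤-trans (s≤s z≤n)
        (ℕ.≤-trans lt (ℕ.≤-reflexive (trans (cong (d ℕ.+_) (count-empty (λ y → gift? y x) not-low)) (ℕ.+-identityʳ d))))))))
      split : ∀ y → A x y → (A x y × 3 ≤ deg y) ⊎ (A x y × 4 ≤ deg x × deg y ≤ 2)
      split y xy with 3 ℕ.≤? deg y
      ... | yes 3≤y = inj₁ (xy , 3≤y)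
      ... | no  3≰y = inj₂ (xy , 4≤x , ℕ.≤-pred (ℕ.≰⇒> 3≰y))

-- Triple systems

∑³ : ∀ {n} → (Fin n → Fin n → Fin n → ℕ) → ℕ
∑³ {n} f = ∑[ x < n ] ∑[ y < n ] ∑[ z < n ] f x y z

module _ {n} (f : Fin n → Fin n → Fin n → ℕ) where

  ∑³-swap₁₂ : ∑³ f ≡ ∑³ λ x y z → f y x z
  ∑³-swap₁₂ = ∑-swap (λ x y → ∑ (f x y))

  ∑³-swap₂₃ : ∑³ f ≡ ∑³ λ x y z → f x z y
  ∑³-swap₂₃ = ∑-cong λ x → ∑-swap (f x)

  ∑³-cong : ∀ {g} → (∀ x y z → f x y z ≡ g x y z) → ∑³ f ≡ ∑³ g
  ∑³-cong f≗g = ∑-cong λ x → ∑-cong λ y → ∑-cong (f≗g x y)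

  ∑³-+ : ∀ g → ∑³ (λ x y z → f x y z + g x y z) ≡ ∑³ f + ∑³ g
  ∑³-+ g = trans
    (∑-cong λ x → trans (∑-cong λ y → ∑-+ (f x y) (g x y))
                                (∑-+ (λ y → ∑ (f x y)) _))
    (∑-+ (λ x → ∑[ y < n ] ∑ (f x y)) _)

  ∑³-* : ∀ c → ∑³ (λ x y z → c * f x y z) ≡ c * ∑³ f
  ∑³-* c = sym (trans (*-distribˡ-∑ c λ x → ∑[ y < n ] ∑ (f x y))
    (∑-cong λ x → trans (*-distribˡ-∑ c λ y → ∑ (f x y))
    (∑-cong λ y → *-distribˡ-∑ c (f x y))))

∑²-<⇒∃< : ∀ {n} (f g : Fin n → Fin n → ℕ) →
          ∑[ x < n ] ∑[ y < n ] f x y < ∑[ x < n ] ∑[ y < n ] g x y → ∃[ x ] ∃[ y ] f x y < g x y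
∑²-<⇒∃< f g lt = let x , ltx = ∑-<⇒∃< (λ x → ∑ (f x)) (λ x → ∑ (g x)) lt in x , ∑-<⇒∃< (f x) (g x) ltx

∑²-* : ∀ {n} c (f : Fin n → Fin n → ℕ) → ∑[ x < n ] ∑[ y < n ] (c * f x y) ≡ c * ∑[ x < n ] ∑[ y < n ] f x y
∑²-* {n} c f = sym (trans (*-distribˡ-∑ c λ x → ∑ (f x)) (∑-cong λ x → *-distribˡ-∑ c (f x)))

∑²-+ : ∀ {n} (f g : Fin n → Fin n → ℕ) → ∑[ x < n ] ∑[ y < n ] (f x y + g x y) ≡
       ∑[ x < n ] ∑[ y < n ] f x y + ∑[ x < n ] ∑[ y < n ] g x y
∑²-+ {n} f g = trans (∑-cong λ x → ∑-+ (f x) (g x)) (∑-+ (λ x → ∑ (f x)) _)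

φ-small : ∀ d → 0 < d → d < 4 → 2 ≤ φ d
φ-small 1 _ _ = s≤s (s≤s z≤n)
φ-small 2 _ _ = s≤s (s≤s z≤n)
φ-small 3 _ _ = s≤s (s≤s z≤n)
φ-small (suc (suc (suc (suc d)))) _ (s≤s (s≤s (s≤s (s≤s ()))))

-- Three degrees at most 3 weigh at least 2 + 2 + 2.
light-max : ∀ d e f → 0 < d → 0 < e → 0 < f → φ d + φ e + φ f < 6 → 4 ≤ d ⊎ 4 ≤ e ⊎ 4 ≤ f
light-max d e f 0<d 0<e 0<f lt with 4 ℕ.≤? d | 4 ℕ.≤? e | 4 ℕ.≤? f
... | yes 4≤d | _ | _ = inj₁ 4≤d
... | no _ | yes 4≤e | _ = inj₂ (inj₁ 4≤e)
... | no _ | no _ | yes 4≤f = inj₂ (inj₂ 4≤f)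
... | no 4≰d | no 4≰e | no 4≰f = contradiction
  (ℕ.+-mono-≤ (ℕ.+-mono-≤ (φ-small d 0<d (ℕ.≰⇒> 4≰d)) (φ-small e 0<e (ℕ.≰⇒> 4≰e))) (φ-small f 0<f (ℕ.≰⇒> 4≰f)))
  (ℕ.<⇒≱ lt)

-- The half-units that a pair of positive degree d gives to each recipient: 3 - d, truncated at 0.
ψ : ℕ → ℕ
ψ 1 = 2
ψ 2 = 1
ψ _ = 0

-- Here d and e are the degrees of x z and y z for a triple x y z. The two half-units that z costs x
-- y are covered by what these pairs give and by the two conditions counted by `I?`.
ψ-deficit : ∀ d e → 0 < d → 0 < e →
  2 ≤ (ψ d + ψ e) + (⟦ (3 ℕ.≤? d) ×-dec (2 ℕ.≤? e) ⟧ + ⟦ (3 ℕ.≤? e) ×-dec (2 ℕ.≤? d) ⟧)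
ψ-deficit 1 e _ _ = s≤s (s≤s z≤n)
ψ-deficit 2 1 _ _ = s≤s (s≤s z≤n)
ψ-deficit 2 2 _ _ = s≤s (s≤s z≤n)
ψ-deficit 2 (suc (suc (suc e))) _ _ = s≤s (s≤s z≤n)
ψ-deficit (suc (suc (suc d))) 1 _ _ = s≤s (s≤s z≤n)
ψ-deficit (suc (suc (suc d))) 2 _ _ = s≤s (s≤s z≤n)
ψ-deficit (suc (suc (suc d))) (suc (suc (suc e))) _ _ = s≤s (s≤s z≤n)

remaining : ∀ {a b k} m → a ≤ k → k + m ≤ a + b → m ≤ b
remaining {b = b} {k} m a≤k le = ℕ.+-cancelˡ-≤ k m b (ℕ.≤-trans le (ℕ.+-monoˡ-≤ b a≤k))

module TripleSystem {n} {H : Fin n → Fin n → Fin n → Set} (H? : ∀ x y z → Dec (H x y z))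
  (swap₁₂ : ∀ {x y z} → H x y z → H y x z) (swap₂₃ : ∀ {x y z} → H x y z → H x z y)
  (H-irrefl : ∀ {x z} → ¬ H x x z) where

  deg : Fin n → Fin n → ℕ
  deg x y = count (H? x y)

  swap₁₃ : ∀ {x y z} → H x y z → H z y x
  swap₁₃ = swap₁₂ ∘ swap₂₃ ∘ swap₁₂

  H⇒≢₁₂ : ∀ {x y z} → H x y z → x ≢ y
  H⇒≢₁₂ h refl = H-irrefl h

  H⇒≢₁₃ : ∀ {x y z} → H x y z → x ≢ z
  H⇒≢₁₃ h refl = H-irrefl (swap₂₃ h)

  H⇒≢₂₃ : ∀ {x y z} → H x y z → y ≢ z
  H⇒≢₂₃ h refl = H-irrefl (swap₁₃ h)

  deg-sym : ∀ x y → deg x y ≡ deg y x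
  deg-sym x y = ∑-cong λ z → ⟦⟧-cong (H? x y z) (H? y x z) swap₁₂ swap₁₂

  H-deg : ∀ {x y z} → H x y z → 0 < deg x y
  H-deg {x} {y} = count-∈ (H? x y)

  Star TightPath : Set
  Star      = ∃[ x ] ∃[ y ] ∃[ z ] ∃[ a ] ∃[ b ] ∃[ c ] Unique (x ∷ y ∷ z ∷ a ∷ b ∷ c ∷ []) ×
              H x y z × H x y a × H x z b × H y z c
  TightPath = ∃[ a ] ∃[ x ] ∃[ q ] ∃[ p ] ∃[ y ] ∃[ b ] Unique (a ∷ x ∷ q ∷ p ∷ y ∷ b ∷ []) ×
              H a x q × H x q p × H q p y × H p y b

  Large : Set
  Large = 3 * ∑[ x < n ] ∑[ y < n ] positive (deg x y) < ∑[ x < n ] ∑[ y < n ] deg x y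

  -- The counting of `light-edge`, now with the weights of three pairs. The three sums agree because
  -- `H` is symmetric, each is at most 6 per ordered pair in the shadow, and 18 is 6 times the 3 in
  -- `Large`.
  light-triple : Large → ∃[ x ] ∃[ y ] ∃[ z ] H x y z × φ (deg x y) + φ (deg x z) + φ (deg y z) < 6
  light-triple large = finish (∑²-<⇒∃< (λ x y → ∑[ z < n ] weight x y z) (λ x y → ∑[ z < n ] (6 * ⟦ H? x y z ⟧)) total)
    where
    weight₁ weight₂ weight₃ weight : Fin n → Fin n → Fin n → ℕ
    weight₁ x y z = ⟦ H? x y z ⟧ * φ (deg x y)
    weight₂ x y z = ⟦ H? x y z ⟧ * φ (deg x z)
    weight₃ x y z = ⟦ H? x y z ⟧ * φ (deg y z)
    weight  x y z = weight₁ x y z + weight₂ x y z + weight₃ x y z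

    third : ℕ
    third = ∑³ weight₁

    weight₂≡ : ∑³ weight₂ ≡ third
    weight₂≡ = trans (∑³-swap₂₃ weight₂) (∑³-cong _ λ x y z →
      cong (_* φ (deg x y)) (⟦⟧-cong (H? x z y) (H? x y z) swap₂₃ swap₂₃))

    weight₃≡ : ∑³ weight₃ ≡ third
    weight₃≡ = trans (∑³-swap₁₂ weight₃) (trans (∑³-cong _ λ x y z →
      cong (_* φ (deg x z)) (⟦⟧-cong (H? y x z) (H? x y z) swap₁₂ swap₁₂)) weight₂≡)

    third≤ : third ≤ 6 * ∑[ x < n ] ∑[ y < n ] positive (deg x y)
    third≤ = begin
      third                                          ≡⟨ ∑-cong (λ x → ∑-cong λ y → *-distribʳ-∑ (φ (deg x y)) (λ z → ⟦ H? x y z ⟧)) ⟨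
      ∑[ x < n ] ∑[ y < n ] (deg x y * φ (deg x y))  ≤⟨ ∑-mono (λ x → ∑-mono λ y → d*φ≤6 (deg x y)) ⟩
      ∑[ x < n ] ∑[ y < n ] (6 * positive (deg x y)) ≡⟨ ∑²-* 6 (λ x y → positive (deg x y)) ⟩
      6 * ∑[ x < n ] ∑[ y < n ] positive (deg x y)   ∎
      where open ℕ.≤-Reasoning

    total : ∑³ weight < ∑³ (λ x y z → 6 * ⟦ H? x y z ⟧)
    total = begin-strict
      ∑³ weight                    ≡⟨ ∑³-+ (λ x y z → weight₁ x y z + weight₂ x y z) weight₃ ⟩
      ∑³ (λ x y z → weight₁ x y z + weight₂ x y z) + ∑³ weight₃ ≡⟨ cong₂ _+_ (∑³-+ weight₁ weight₂) weight₃≡ ⟩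
      third + ∑³ weight₂ + third   ≡⟨ cong (λ s → third + s + third) weight₂≡ ⟩
      third + third + third        ≤⟨ ℕ.+-mono-≤ (ℕ.+-mono-≤ third≤ third≤) third≤ ⟩
      6 * V + 6 * V + 6 * V        ≡⟨ solve 1 (λ v → con 6 :* v :+ con 6 :* v :+ con 6 :* v := con 6 :* (con 3 :* v)) refl V ⟩
      6 * (3 * V)                  <⟨ ℕ.*-monoʳ-< 6 large ⟩
      6 * ∑³ (λ x y z → ⟦ H? x y z ⟧) ≡⟨ ∑³-* (λ x y z → ⟦ H? x y z ⟧) 6 ⟨
      ∑³ (λ x y z → 6 * ⟦ H? x y z ⟧) ∎
      where
      open ℕ.≤-Reasoning
      open +-*-Solver using (solve; _:*_; _:+_; con; _:=_)
      V = ∑[ x < n ] ∑[ y < n ] positive (deg x y)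

    extract : ∀ {x y z i j k} (h : Dec (H x y z)) → ⟦ h ⟧ * i + ⟦ h ⟧ * j + ⟦ h ⟧ * k < 6 * ⟦ h ⟧ →
              H x y z × i + j + k < 6
    extract {i = i} {j} {k} (yes h) lt = h , subst (_< 6)
      (cong₂ _+_ (cong₂ _+_ (ℕ.*-identityˡ i) (ℕ.*-identityˡ j)) (ℕ.*-identityˡ k)) lt
    extract (no _)  lt = contradiction lt λ ()

    finish : ∃[ x ] ∃[ y ] ∑[ z < n ] weight x y z < ∑[ z < n ] (6 * ⟦ H? x y z ⟧) →
             ∃[ x ] ∃[ y ] ∃[ z ] H x y z × φ (deg x y) + φ (deg x z) + φ (deg y z) < 6
    finish (x , y , ltxy) =
      let z , ltxyz = ∑-<⇒∃< (weight x y) (λ z → 6 * ⟦ H? x y z ⟧) ltxy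
      in  x , y , z , extract (H? x y z) ltxyz

  -- The leaves are attached in order of increasing degree: each avoids the opposite vertex of the
  -- triple and the leaves already placed.
  star-from : ∀ {x y z} → H x y z → 2 ≤ deg x y → 3 ≤ deg x z → 4 ≤ deg y z → Star
  star-from {x} {y} {z} h 2≤xy 3≤xz 4≤yz with pick (H? x y) (z ∷ []) 2≤xy
  ... | a , xya , a≢z ∷ [] with pick (H? x z) (y ∷ a ∷ []) 3≤xz
  ...   | b , xzb , b≢y ∷ b≢a ∷ [] with pick (H? y z) (x ∷ a ∷ b ∷ []) 4≤yz
  ...     | c , yzc , c≢x ∷ c≢a ∷ c≢b ∷ [] =
    x , y , z , a , b , c
    , (H⇒≢₁₂ h ∷ H⇒≢₁₃ h ∷ H⇒≢₁₃ xya ∷ H⇒≢₁₃ xzb ∷ ≢-sym c≢x ∷ [])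
      ∷ (H⇒≢₂₃ h ∷ H⇒≢₂₃ xya ∷ ≢-sym b≢y ∷ H⇒≢₁₃ yzc ∷ [])
      ∷ (≢-sym a≢z ∷ H⇒≢₂₃ xzb ∷ H⇒≢₂₃ yzc ∷ [])
      ∷ (≢-sym b≢a ∷ ≢-sym c≢a ∷ []) ∷ (≢-sym c≢b ∷ []) ∷ [] ∷ []
    , h , xya , xzb , yzc

  star : Large → Star
  star large = finish (light-triple large)
    where
    -- Once a pair of degree at least 4 is found, the other two weigh less than 6 together, so
    -- `light₂` supplies the degrees 2 and 3.
    order : ∀ {x y z} → H x y z → 4 ≤ deg x y → φ (deg x z) + φ (deg y z) < 6 → Star
    order {x} {y} {z} h 4≤xy lt with light₂ (deg x z) (deg y z) (H-deg (swap₂₃ h)) (H-deg (swap₂₃ (swap₁₂ h))) lt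
    ... | 2≤xz , 2≤yz , inj₁ 3≤xz = star-from (swap₁₃ h)
          (subst (2 ≤_) (deg-sym y z) 2≤yz) (subst (3 ≤_) (deg-sym x z) 3≤xz) (subst (4 ≤_) (deg-sym x y) 4≤xy)
    ... | 2≤xz , 2≤yz , inj₂ 3≤yz = star-from (swap₁₂ (swap₂₃ h))
          (subst (2 ≤_) (deg-sym x z) 2≤xz) (subst (3 ≤_) (deg-sym y z) 3≤yz) 4≤xy

    finish : ∃[ x ] ∃[ y ] ∃[ z ] H x y z × φ (deg x y) + φ (deg x z) + φ (deg y z) < 6 → Star
    finish (x , y , z , h , lt) with light-max _ _ _ (H-deg h) (H-deg (swap₂₃ h)) (H-deg (swap₂₃ (swap₁₂ h))) lt
    ... | inj₁ 4≤xy = order h 4≤xy (ℕ.≤-trans (s≤s (ℕ.≤-trans (ℕ.m≤n+m _ (φ (deg x y))) (ℕ.≤-reflexive (sym (ℕ.+-assoc (φ (deg x y)) _ _))))) lt)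
    ... | inj₂ (inj₁ 4≤xz) = order (swap₂₃ h) 4≤xz (ℕ.≤-trans
          (s≤s (ℕ.+-mono-≤ (ℕ.m≤m+n _ (φ (deg x z))) (ℕ.≤-reflexive (cong φ (deg-sym z y))))) lt)
    ... | inj₂ (inj₂ 4≤yz) = order (swap₁₂ (swap₁₃ h)) 4≤yz (ℕ.≤-trans
          (s≤s (ℕ.≤-trans (ℕ.+-mono-≤ (ℕ.≤-reflexive (cong φ (deg-sym y x))) (ℕ.≤-reflexive (cong φ (deg-sym z x))))
            (ℕ.m≤m+n _ (φ (deg y z))))) lt)

  -- The pair q p lies in the two inner triples of the path a l q p m b; l and m complete them,
  -- while a and b extend the pairs q l and p m.
  tight-path-from : ∀ {q p l m a b} → H q p l → H q p m → l ≢ m → H q l a → a ≢ p → a ≢ m →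
                    H p m b → b ≢ q → b ≢ l → a ≢ b → TightPath
  tight-path-from {q} {p} {l} {m} {a} {b} qpl qpm l≢m qla a≢p a≢m pmb b≢q b≢l a≢b =
    a , l , q , p , m , b
    , (≢-sym (H⇒≢₂₃ qla) ∷ ≢-sym (H⇒≢₁₃ qla) ∷ a≢p ∷ a≢m ∷ a≢b ∷ [])
      ∷ (≢-sym (H⇒≢₁₃ qpl) ∷ ≢-sym (H⇒≢₂₃ qpl) ∷ l≢m ∷ ≢-sym b≢l ∷ [])
      ∷ (H⇒≢₁₂ qpl ∷ H⇒≢₁₃ qpm ∷ ≢-sym b≢q ∷ []) ∷ (H⇒≢₂₃ qpm ∷ H⇒≢₁₃ pmb ∷ []) ∷ (H⇒≢₂₃ pmb ∷ []) ∷ [] ∷ []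
    , swap₁₃ qla , swap₁₃ (swap₁₂ qpl) , qpm , pmb

  -- A third vertex z costs the pair q p half a unit if I? q p z holds, and another
  -- half if I? p q z holds; the rest of its unit is received in the discharging below.
  I? : ∀ q p z → Dec (H q p z × 3 ≤ deg q z × 2 ≤ deg p z)
  I? q p z = H? q p z ×-dec (3 ℕ.≤? deg q z) ×-dec (2 ℕ.≤? deg p z)

  -- Two candidates m, y and m′, y′ are prepared on the side of p, and l avoids all four. If q l
  -- extends compatibly with neither, its third vertices lie both among p, m, y and among p, m′, y′.
  -- By degree 3 some third vertex differs from p and y′, so it is m′, which was chosen off m and y.
  tight-path-I : ∀ q p → 5 ≤ count (I? q p) → TightPath
  tight-path-I q p 5≤ with pick (I? q p) [] (ℕ.m+n≤o⇒m≤o 1 5≤)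
  ... | m , (qpm , _ , 2≤pm) , [] with pick (H? p m) (q ∷ []) 2≤pm
  ...   | y , pmy , y≢q ∷ [] with pick (I? q p) (m ∷ y ∷ []) (ℕ.m+n≤o⇒m≤o 3 5≤)
  ...     | m′ , (qpm′ , _ , 2≤pm′) , m′≢m ∷ m′≢y ∷ [] with pick (H? p m′) (q ∷ []) 2≤pm′
  ...       | y′ , pm′y′ , y′≢q ∷ [] with pick (I? q p) (m ∷ m′ ∷ y ∷ y′ ∷ []) 5≤
  ...         | l , (qpl , 3≤ql , _) , l≢m ∷ l≢m′ ∷ l≢y ∷ l≢y′ ∷ [] with avoid? (H? q l) (p ∷ m ∷ y ∷ [])
  ...           | inj₁ (a , qla , a≢p ∷ a≢m ∷ a≢y ∷ []) =
    tight-path-from qpl qpm l≢m qla a≢p a≢m pmy y≢q (≢-sym l≢y) a≢y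
  ...           | inj₂ cover with avoid? (H? q l) (p ∷ m′ ∷ y′ ∷ [])
  ...             | inj₁ (a , qla , a≢p ∷ a≢m′ ∷ a≢y′ ∷ []) =
    tight-path-from qpl qpm′ l≢m′ qla a≢p a≢m′ pm′y′ y′≢q (≢-sym l≢y′) a≢y′
  ...             | inj₂ cover′ with pick (H? q l) (p ∷ y′ ∷ []) 3≤ql
  ...               | w , qlw , w≢p ∷ w≢y′ ∷ [] with cover qlw | cover′ qlw
  ... | here w≡p | _ = contradiction w≡p w≢p
  ... | _ | here w≡p = contradiction w≡p w≢p
  ... | _ | there (there (here w≡y′)) = contradiction w≡y′ w≢y′
  ... | there (here refl) | there (here m≡m′) = contradiction (sym m≡m′) m′≢m
  ... | there (there (here refl)) | there (here y≡m′) = contradiction (sym y≡m′) m′≢y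

  -- The vertex j is used on the side of p. If no end is compatible with i and a, the third vertices
  -- of p j lie among q, i, a. Replacing i by a vertex k other than i and a then makes every end
  -- found for p j differ from k.
  tight-path-mixed : ∀ q p {j} → 4 ≤ count (I? q p) → H q p j → 3 ≤ deg p j → TightPath
  tight-path-mixed q p {j} 4≤ qpj 3≤pj with pick (I? q p) (j ∷ []) (ℕ.m+n≤o⇒m≤o 2 4≤)
  ... | i , (qpi , 3≤qi , _) , i≢j ∷ [] with pick (H? q i) (p ∷ j ∷ []) 3≤qi
  ...   | a , qia , a≢p ∷ a≢j ∷ [] with avoid? (H? p j) (q ∷ i ∷ a ∷ [])
  ...     | inj₁ (b , pjb , b≢q ∷ b≢i ∷ b≢a ∷ []) =
    tight-path-from qpi qpj i≢j qia a≢p a≢j pjb b≢q b≢i (≢-sym b≢a)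
  ...     | inj₂ cover with pick (I? q p) (j ∷ i ∷ a ∷ []) 4≤
  ...       | k , (qpk , 3≤qk , _) , k≢j ∷ k≢i ∷ k≢a ∷ [] with pick (H? q k) (p ∷ j ∷ []) 3≤qk
  ...         | c , qkc , c≢p ∷ c≢j ∷ [] with pick (H? p j) (q ∷ c ∷ []) 3≤pj
  ...           | b , pjb , b≢q ∷ b≢c ∷ [] =
    tight-path-from qpk qpj k≢j qkc c≢p c≢j pjb b≢q b≢k (≢-sym b≢c)
    where
    b≢k : b ≢ k
    b≢k refl with cover pjb
    ... | here k≡q                 = b≢q k≡q
    ... | there (here k≡i)         = k≢i k≡i
    ... | there (there (here k≡a)) = k≢a k≡a

  -- The third vertices z for which x z can receive from x y; `H x z y` has the argument order of
  -- `τ x z y`, whose indicator this is.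
  rich? : ∀ x y z → Dec (H x z y × 4 ≤ deg x z)
  rich? x y z = H? x z y ×-dec (4 ℕ.≤? deg x z)

  rich≤deg : ∀ x y → count (rich? x y) ≤ deg x y
  rich≤deg x y = count-mono (rich? x y) (H? x y) (swap₂₃ ∘ proj₁)

  -- As in `path₄-low`, the rich pairs on both sides of q p leave room for greedy ends.
  tight-path-low : ∀ q p → 2 ≤ count (rich? q p) → 1 ≤ count (rich? p q) → TightPath
  tight-path-low q p 2≤ 1≤ with pick (rich? p q) [] 1≤
  ... | m , (pmq , 4≤pm) , [] with pick (rich? q p) (m ∷ []) 2≤
  ...   | l , (qlp , 4≤ql) , l≢m ∷ [] with pick (H? q l) (p ∷ m ∷ []) (ℕ.<⇒≤ 4≤ql)
  ...     | a , qla , a≢p ∷ a≢m ∷ [] with pick (H? p m) (q ∷ l ∷ a ∷ []) 4≤pm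
  ...       | b , pmb , b≢q ∷ b≢l ∷ b≢a ∷ [] =
    tight-path-from (swap₂₃ qlp) (swap₁₂ (swap₂₃ pmq)) l≢m qla a≢p a≢m pmb b≢q b≢l (≢-sym b≢a)

  -- Discharging: the pair x z gives ψ (deg x z) half-units to x y whenever x y z
  -- is an edge and x y has codegree at least 4.
  τ : Fin n → Fin n → Fin n → ℕ
  τ x y z = ⟦ H? x y z ×-dec (4 ℕ.≤? deg x y) ⟧ * ψ (deg x z)

  received given : Fin n → Fin n → ℕ
  received x y = ∑[ z < n ] (τ x y z + τ y x z)
  given    x y = ∑[ z < n ] (τ x z y + τ y z x)

  ∑given≡∑received : ∑[ x < n ] ∑[ y < n ] given x y ≡ ∑[ x < n ] ∑[ y < n ] received x y
  ∑given≡∑received = begin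
    ∑³ (λ x y z → τ x z y + τ y z x)         ≡⟨ ∑³-+ (λ x y z → τ x z y) (λ x y z → τ y z x) ⟩
    ∑³ (λ x y z → τ x z y) + ∑³ (λ x y z → τ y z x)
      ≡⟨ cong₂ _+_ (∑³-swap₂₃ τ) (trans (∑³-swap₂₃ τ) (∑³-swap₁₂ (λ x y z → τ x z y))) ⟨
    ∑³ τ + ∑³ τ                              ≡⟨ cong (_+_ (∑³ τ)) (∑³-swap₁₂ τ) ⟩
    ∑³ τ + ∑³ (λ x y z → τ y x z)            ≡⟨ ∑³-+ τ (λ x y z → τ y x z) ⟨
    ∑³ (λ x y z → τ x y z + τ y x z)         ∎
    where open ≡-Reasoning

  -- All quantities are doubled, because the discharging moves half-units: the allowance 3 becomes
  -- 6.
  surplus : Large → ∃[ x ] ∃[ y ] 6 * positive (deg x y) + received x y < 2 * deg x y + given x y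
  surplus large = ∑²-<⇒∃< (λ x y → 6 * positive (deg x y) + received x y) (λ x y → 2 * deg x y + given x y) (begin-strict
    ∑[ x < n ] ∑[ y < n ] (6 * positive (deg x y) + received x y)  ≡⟨ ∑²-+ (λ x y → 6 * positive (deg x y)) received ⟩
    ∑[ x < n ] ∑[ y < n ] (6 * positive (deg x y)) + R             ≡⟨ cong (_+ R) (∑²-* 6 (λ x y → positive (deg x y))) ⟩
    6 * V + R                                                      ≡⟨ cong (_+ R) (ℕ.*-assoc 2 3 V) ⟩
    2 * (3 * V) + R                                                <⟨ ℕ.+-monoˡ-< R (ℕ.*-monoʳ-< 2 large) ⟩
    2 * ∑[ x < n ] ∑[ y < n ] deg x y + R                          ≡⟨ cong₂ _+_ (∑²-* 2 deg) ∑given≡∑received ⟨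
    ∑[ x < n ] ∑[ y < n ] (2 * deg x y) + ∑[ x < n ] ∑[ y < n ] given x y  ≡⟨ ∑²-+ (λ x y → 2 * deg x y) given ⟨
    ∑[ x < n ] ∑[ y < n ] (2 * deg x y + given x y)                ∎)
    where
    open ℕ.≤-Reasoning
    R = ∑[ x < n ] ∑[ y < n ] received x y
    V = ∑[ x < n ] ∑[ y < n ] positive (deg x y)

  given≡ : ∀ x y → given x y ≡ (count (rich? x y) + count (rich? y x)) * ψ (deg x y)
  given≡ x y = begin
    given x y
      ≡⟨ ∑-cong (λ z → cong (λ d → ⟦ rich? x y z ⟧ * ψ (deg x y) + ⟦ rich? y x z ⟧ * ψ d) (deg-sym y x)) ⟩
    ∑[ z < n ] (⟦ rich? x y z ⟧ * ψ (deg x y) + ⟦ rich? y x z ⟧ * ψ (deg x y))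
      ≡⟨ ∑-cong (λ z → ℕ.*-distribʳ-+ (ψ (deg x y)) ⟦ rich? x y z ⟧ ⟦ rich? y x z ⟧) ⟨
    ∑[ z < n ] ((⟦ rich? x y z ⟧ + ⟦ rich? y x z ⟧) * ψ (deg x y))
      ≡⟨ *-distribʳ-∑ (ψ (deg x y)) (λ z → ⟦ rich? x y z ⟧ + ⟦ rich? y x z ⟧) ⟨
    (∑[ z < n ] (⟦ rich? x y z ⟧ + ⟦ rich? y x z ⟧)) * ψ (deg x y)
      ≡⟨ cong (_* ψ (deg x y)) (∑-+ (λ z → ⟦ rich? x y z ⟧) (λ z → ⟦ rich? y x z ⟧)) ⟩
    (count (rich? x y) + count (rich? y x)) * ψ (deg x y) ∎
    where open ≡-Reasoning

  -- This is `ψ-deficit` summed over the third vertices. Degree 4 makes x y a recipient in every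
  -- triple on it.
  2*deg≤ : ∀ x y → 4 ≤ deg x y → 2 * deg x y ≤ received x y + (count (I? x y) + count (I? y x))
  2*deg≤ x y 4≤xy = begin
    2 * deg x y                  ≡⟨ *-distribˡ-∑ 2 (λ z → ⟦ H? x y z ⟧) ⟩
    ∑[ z < n ] (2 * ⟦ H? x y z ⟧)  ≤⟨ ∑-mono (λ z → pointwise z (H? x y z)) ⟩
    ∑[ z < n ] ((τ x y z + τ y x z) + (⟦ I? x y z ⟧ + ⟦ I? y x z ⟧))  ≡⟨ ∑-+ (λ z → τ x y z + τ y x z) (λ z → ⟦ I? x y z ⟧ + ⟦ I? y x z ⟧) ⟩
    received x y + ∑[ z < n ] (⟦ I? x y z ⟧ + ⟦ I? y x z ⟧)  ≡⟨ cong (_+_ (received x y)) (∑-+ (λ z → ⟦ I? x y z ⟧) (λ z → ⟦ I? y x z ⟧)) ⟩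
    received x y + (count (I? x y) + count (I? y x))     ∎
    where
    open ℕ.≤-Reasoning
    τ-edge : ∀ {u v} z → H u v z → 4 ≤ deg u v → τ u v z ≡ ψ (deg u z)
    τ-edge {u} {v} z h 4≤ = trans
      (cong (_* ψ (deg u z)) (⟦⟧-true (H? u v z ×-dec (4 ℕ.≤? deg u v)) (h , 4≤))) (ℕ.*-identityˡ _)
    I-edge : ∀ {u v} z → H u v z →
             ⟦ (3 ℕ.≤? deg u z) ×-dec (2 ℕ.≤? deg v z) ⟧ ≤ ⟦ I? u v z ⟧
    I-edge {u} {v} z h = ⟦⟧-mono ((3 ℕ.≤? deg u z) ×-dec (2 ℕ.≤? deg v z)) (I? u v z) (h ,_)
    pointwise : ∀ z (h : Dec (H x y z)) → 2 * ⟦ h ⟧ ≤ (τ x y z + τ y x z) + (⟦ I? x y z ⟧ + ⟦ I? y x z ⟧)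
    pointwise z (no _)  = z≤n
    pointwise z (yes h) = ℕ.≤-trans
      (ψ-deficit (deg x z) (deg y z) (H-deg (swap₂₃ h)) (H-deg (swap₂₃ (swap₁₂ h))))
      (ℕ.+-mono-≤
        (ℕ.≤-reflexive (sym (cong₂ _+_ (τ-edge z h 4≤xy) (τ-edge z (swap₁₂ h) (subst (4 ≤_) (deg-sym x y) 4≤xy)))))
        (ℕ.+-mono-≤ (I-edge z h) (I-edge z (swap₁₂ h))))

  -- Unless one of the counts reaches 5, a total of 7 means that one is 4 and the other at least 3.
  -- Any vertex of the other count then serves as j in the mixed case.
  tight-path-II : ∀ x y → 7 ≤ count (I? x y) + count (I? y x) → TightPath
  tight-path-II x y 7≤ = cases (5 ℕ.≤? count (I? x y)) (5 ℕ.≤? count (I? y x)) (4 ℕ.≤? count (I? x y))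
    where
    mixed : ∀ x y → 4 ≤ count (I? x y) → 3 ≤ count (I? y x) → TightPath
    mixed x y 4≤ 3≤ with pick (I? y x) [] (ℕ.≤-trans (s≤s z≤n) 3≤)
    ... | j , (yxj , 3≤yj , _) , [] = tight-path-mixed x y 4≤ (swap₁₂ yxj) 3≤yj

    cases : Dec (5 ≤ count (I? x y)) → Dec (5 ≤ count (I? y x)) → Dec (4 ≤ count (I? x y)) → TightPath
    cases (yes 5≤) _        _         = tight-path-I x y 5≤
    cases (no _)   (yes 5≤) _         = tight-path-I y x 5≤
    cases (no 5≰I) (no _)   (yes 4≤I) = mixed x y 4≤I (remaining 3 (ℕ.≤-pred (ℕ.≰⇒> 5≰I)) 7≤)
    cases (no _)   (no 5≰J) (no 4≰I)  = mixed y x (remaining 4 (ℕ.≤-pred (ℕ.≰⇒> 4≰I)) 7≤)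
      (remaining 3 (ℕ.≤-pred (ℕ.≰⇒> 5≰J)) (subst (7 ≤_) (ℕ.+-comm (count (I? x y)) _) 7≤))

  tight-path : Large → TightPath
  tight-path large = finish (surplus large)
    where
    cases : ∀ x y d → deg x y ≡ d → count (rich? x y) ≤ d → count (rich? y x) ≤ d →
            6 * positive d + received x y < 2 * d + (count (rich? x y) + count (rich? y x)) * ψ d → TightPath
    -- Degrees 0 and 1 leave no surplus: `ψ 0` is 0, and a pair of degree 1 gives at most 4
    -- half-units on top of its own 2.
    cases x y 0 eq α≤ β≤ lt = contradiction (ℕ.≤-trans lt (ℕ.≤-reflexive (ℕ.*-zeroʳ (count (rich? x y) + count (rich? y x))))) λ ()
    cases x y 1 eq α≤ β≤ lt = contradiction
      (ℕ.≤-trans lt (ℕ.+-monoʳ-≤ 2 (ℕ.*-monoˡ-≤ 2 (ℕ.+-mono-≤ α≤ β≤)))) (ℕ.m+n≮m 6 (received x y))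
    -- A pair of degree 2 gives one half-unit at a time, so the surplus means at least 3 recipients,
    -- with at most 2 on either side.
    cases x y 2 eq α≤ β≤ lt = low (2 ℕ.≤? count (rich? x y))
      where
      3≤ : 3 ≤ count (rich? x y) + count (rich? y x)
      3≤ = ℕ.≤-trans (ℕ.m≤m+n 3 (received x y)) (ℕ.+-cancelˡ-≤ 4 _ _
        (ℕ.≤-trans lt (ℕ.≤-reflexive (cong (_+_ 4) (ℕ.*-identityʳ (count (rich? x y) + count (rich? y x)))))))

      low : Dec (2 ≤ count (rich? x y)) → TightPath
      low (yes 2≤α) = tight-path-low x y 2≤α (remaining 1 α≤ 3≤)
      low (no  2≰α) = tight-path-low y x (remaining 2 (ℕ.≤-pred (ℕ.≰⇒> 2≰α)) 3≤)
        (remaining 1 β≤ (subst (3 ≤_) (ℕ.+-comm (count (rich? x y)) _) 3≤))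

    -- From degree 3 on nothing is given, as `ψ` vanishes; the surplus then forces degree at least
    -- 4.
    cases x y d@(suc (suc (suc d′))) eq _ _ lt = tight-path-II x y (ℕ.+-cancelˡ-≤ (received x y) 7 _ (begin
      received x y + 7                         ≡⟨ ℕ.+-comm (received x y) 7 ⟩
      suc (6 + received x y)                   ≤⟨ lt′ ⟩
      2 * d                                    ≡⟨ cong (2 *_) eq ⟨
      2 * deg x y                              ≤⟨ 2*deg≤ x y 4≤xy ⟩
      received x y + (count (I? x y) + count (I? y x)) ∎))
      where
      open ℕ.≤-Reasoning
      lt′ : 6 + received x y < 2 * d
      lt′ = ℕ.≤-trans lt (ℕ.≤-reflexive (trans
        (cong (2 * d ℕ.+_) (ℕ.*-zeroʳ (count (rich? x y) + count (rich? y x)))) (ℕ.+-identityʳ (2 * d))))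
      4≤xy : 4 ≤ deg x y
      4≤xy = subst (4 ≤_) (sym eq) (ℕ.*-cancelˡ-< 2 3 d (ℕ.≤-trans (s≤s (ℕ.m≤m+n 6 (received x y))) lt′))

    finish : ∃[ x ] ∃[ y ] 6 * positive (deg x y) + received x y < 2 * deg x y + given x y → TightPath
    finish (x , y , lt) = cases x y (deg x y) refl (rich≤deg x y) (subst (count (rich? y x) ≤_) (deg-sym y x) (rich≤deg y x))
      (subst (λ g → 6 * positive (deg x y) + received x y < 2 * deg x y + g) (given≡ x y) lt)

-- Links and shadows of set families

infixl 6 _⊕_
_⊕_ : Subset n → Fin n → Subset n
D ⊕ x = D ∪ ⁅ x ⁆

module _ {D : Subset n} where

  x∈D⊕x : ∀ {x} → x ∈ D ⊕ x
  x∈D⊕x {x} = x∈p∪q⁺ {p = D} (inj₂ (x∈⁅x⁆ x))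

  ⊕⁺ : ∀ {x y} → y ∈ D → y ∈ D ⊕ x
  ⊕⁺ y∈D = x∈p∪q⁺ (inj₁ y∈D)

  ⊕⁻ : ∀ {x y} → y ∈ D ⊕ x → y ∈ D ⊎ y ≡ x
  ⊕⁻ {x} y∈ with x∈p∪q⁻ D ⁅ x ⁆ y∈
  ... | inj₁ y∈D = inj₁ y∈D
  ... | inj₂ y∈x = inj₂ (x∈⁅y⁆⇒x≡y x y∈x)

  ∉⊕ : ∀ {x y} → y ∉ D → y ≢ x → y ∉ D ⊕ x
  ∉⊕ y∉D y≢x y∈ = [ y∉D , y≢x ]′ (⊕⁻ y∈)

⊕-comm : ∀ (D : Subset n) x y → D ⊕ x ⊕ y ≡ D ⊕ y ⊕ x
⊕-comm D x y = trans (∪-assoc D ⁅ x ⁆ ⁅ y ⁆) (trans (cong (D ∪_) (∪-comm ⁅ x ⁆ ⁅ y ⁆)) (sym (∪-assoc D ⁅ y ⁆ ⁅ x ⁆)))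

∣⊕∣ : ∀ (D : Subset n) x → x ∉ D → ∣ D ⊕ x ∣ ≡ suc ∣ D ∣
∣⊕∣ (true  ∷ D) zero    x∉ = contradiction here x∉
∣⊕∣ (false ∷ D) zero    x∉ = cong (suc ∘ ∣_∣) (∪-identityʳ D)
∣⊕∣ (true  ∷ D) (suc x) x∉ = cong suc (∣⊕∣ D x (x∉ ∘ there))
∣⊕∣ (false ∷ D) (suc x) x∉ = ∣⊕∣ D x (x∉ ∘ there)

x∉p-x : ∀ (p : Subset n) x → x ∉ p - x
x∉p-x (_ ∷ p) zero    ()
x∉p-x (_ ∷ p) (suc x) (there x∈) = x∉p-x p x x∈

-⊕ : ∀ {p : Subset n} {x} → x ∈ p → (p - x) ⊕ x ≡ p
-⊕ {p = p} {x} x∈p = ⊆-antisym to from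
  where
  to : (p - x) ⊕ x ⊆ p
  to y∈ with ⊕⁻ y∈
  ... | inj₁ y∈p-x = p─q⊆p p ⁅ x ⁆ y∈p-x
  ... | inj₂ refl  = x∈p
  from : p ⊆ (p - x) ⊕ x
  from {y} y∈p with y Fin.≟ x
  ... | yes refl = x∈D⊕x {D = p - x}
  ... | no  y≢x  = ⊕⁺ (x∈p∧x≢y⇒x∈p-y y∈p y≢x)

∣p-x∣ : ∀ {p : Subset n} {x} → x ∈ p → suc ∣ p - x ∣ ≡ ∣ p ∣
∣p-x∣ {p = p} {x} x∈p = trans (sym (∣⊕∣ (p - x) x (x∉p-x p x))) (cong ∣_∣ (-⊕ x∈p))

⊆∧∣≤∣⇒≡ : ∀ {p q : Subset n} → p ⊆ q → ∣ q ∣ ≤ ∣ p ∣ → p ≡ q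
⊆∧∣≤∣⇒≡ {p = p} {q} p⊆q q≤p = ⊆-antisym p⊆q q⊆p
  where
  q⊆p : q ⊆ p
  q⊆p {x} x∈q with x ∈? p
  ... | yes x∈p = x∈p
  ... | no  x∉p = contradiction q≤p (ℕ.<⇒≱ (p⊂q⇒∣p∣<∣q∣ (p⊆q , x , x∈q , x∉p)))

count-∈? : ∀ (p : Subset n) → count (_∈? p) ≡ ∣ p ∣
count-∈? []      = count-empty (_∈? []) λ ()
count-∈? (s ∷ p) = trans (∑-suc λ x → ⟦ x ∈? (s ∷ p) ⟧) (head s)
  where
  tail : ∀ s → ∑ (λ x → ⟦ suc x ∈? (s ∷ p) ⟧) ≡ ∣ p ∣
  tail s = trans (∑-cong λ x → ⟦⟧-cong (suc x ∈? (s ∷ p)) (x ∈? p) (λ { (there x∈) → x∈ }) there) (count-∈? p)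
  head : ∀ s → ⟦ zero ∈? (s ∷ p) ⟧ + ∑ (λ x → ⟦ suc x ∈? (s ∷ p) ⟧) ≡ ∣ s ∷ p ∣
  head true  = cong suc (tail true)
  head false = tail false

∑-one : ∀ n → ∑ {n} (λ _ → 1) ≡ n
∑-one zero    = trans (∑-cong λ ()) (∑-zero 0)
∑-one (suc n) = trans (∑-suc λ _ → 1) (cong suc (∑-one n))

count-∉? : ∀ (p : Subset n) → count (λ x → ¬? (x ∈? p)) ≡ n ∸ ∣ p ∣
count-∉? {n} p = trans (sym (ℕ.m+n∸m≡n ∣ p ∣ _)) (cong (_∸ ∣ p ∣) (begin
  ∣ p ∣ + count (λ x → ¬? (x ∈? p))           ≡⟨ cong (_+ count (λ x → ¬? (x ∈? p))) (count-∈? p) ⟨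
  count (_∈? p) + count (λ x → ¬? (x ∈? p))   ≡⟨ ∑-+ (λ x → ⟦ x ∈? p ⟧) (λ x → ⟦ ¬? (x ∈? p) ⟧) ⟨
  ∑ (λ x → ⟦ x ∈? p ⟧ + ⟦ ¬? (x ∈? p) ⟧)      ≡⟨ ∑-cong (λ x → complement (x ∈? p)) ⟩
  ∑ {n} (λ _ → 1)                             ≡⟨ ∑-one n ⟩
  n                                           ∎))
  where
  open ≡-Reasoning
  complement : ∀ {P : Set} (d : Dec P) → ⟦ d ⟧ + ⟦ ¬? d ⟧ ≡ 1
  complement (yes _) = refl
  complement (no _)  = refl

-- The new vertices are added in order, so a set reached from D is counted r ! times.
extensions : (Subset n → ℕ) → ℕ → Subset n → ℕ
extensions W zero    D = W D
extensions W (suc r) D = ∑ λ x → ⟦ ¬? (x ∈? D) ⟧ * extensions W r (D ⊕ x)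

extensions-mono : ∀ {V W : Subset n → ℕ} → (∀ D → V D ≤ W D) → ∀ r D → extensions V r D ≤ extensions W r D
extensions-mono V≤W zero    D = V≤W D
extensions-mono V≤W (suc r) D = ∑-mono λ x → ℕ.*-monoʳ-≤ ⟦ ¬? (x ∈? D) ⟧ (extensions-mono V≤W r (D ⊕ x))

extensions-+ : ∀ (V W : Subset n → ℕ) r D →
               extensions (λ e → V e + W e) r D ≡ extensions V r D + extensions W r D
extensions-+ V W zero    D = refl
extensions-+ V W (suc r) D = trans
  (∑-cong λ x → trans (cong (⟦ ¬? (x ∈? D) ⟧ *_) (extensions-+ V W r (D ⊕ x)))
                      (ℕ.*-distribˡ-+ ⟦ ¬? (x ∈? D) ⟧ _ _))
  (∑-+ (λ x → ⟦ ¬? (x ∈? D) ⟧ * extensions V r (D ⊕ x)) _)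

-- The vertices of e outside D can be added in any order: in the step there are at least `suc r`
-- choices for the first one, and induction counts the rest.
r!≤extensions : ∀ (e : Subset n) r D → D ⊆ e → ∣ e ∣ ≡ ∣ D ∣ + r → r ! ≤ extensions (λ d → ⟦ d ≟ˢ e ⟧) r D
r!≤extensions e zero D D⊆e eq = ℕ.≤-reflexive (sym (⟦⟧-true (D ≟ˢ e)
  (⊆∧∣≤∣⇒≡ D⊆e (ℕ.≤-reflexive (trans eq (ℕ.+-identityʳ ∣ D ∣))))))
r!≤extensions e (suc r) D D⊆e eq = begin
  suc r * r !                               ≤⟨ ℕ.*-monoˡ-≤ (r !) r<new ⟩
  count new? * r !                          ≡⟨ *-distribʳ-∑ (r !) (λ x → ⟦ new? x ⟧) ⟩
  ∑ (λ x → ⟦ new? x ⟧ * r !)                ≤⟨ ∑-mono (λ x → step x (x ∈? D) (x ∈? e)) ⟩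
  extensions (λ d → ⟦ d ≟ˢ e ⟧) (suc r) D   ∎
  where
  open ℕ.≤-Reasoning
  new? : ∀ x → Dec (x ∉ D × x ∈ e)
  new? x = ¬? (x ∈? D) ×-dec (x ∈? e)

  r<new : r < count new?
  r<new = ℕ.+-cancelˡ-≤ ∣ D ∣ (suc r) _ (begin
    ∣ D ∣ + suc r                              ≡⟨ trans (sym eq) (sym (count-∈? e)) ⟩
    count (_∈? e)                              ≤⟨ ∑-mono (λ x → ⟦⟧-⊎ (x ∈? e) (x ∈? D) (new? x) (split x)) ⟩
    ∑ (λ x → ⟦ x ∈? D ⟧ + ⟦ new? x ⟧)          ≡⟨ ∑-+ (λ x → ⟦ x ∈? D ⟧) (λ x → ⟦ new? x ⟧) ⟩
    count (_∈? D) + count new?                 ≡⟨ cong (_+ count new?) (count-∈? D) ⟩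
    ∣ D ∣ + count new?                         ∎)
    where
    split : ∀ x → x ∈ e → x ∈ D ⊎ (x ∉ D × x ∈ e)
    split x x∈e with x ∈? D
    ... | yes x∈D = inj₁ x∈D
    ... | no  x∉D = inj₂ (x∉D , x∈e)

  step : ∀ x (d : Dec (x ∈ D)) (d′ : Dec (x ∈ e)) →
         ⟦ ¬? d ×-dec d′ ⟧ * r ! ≤ ⟦ ¬? d ⟧ * extensions (λ d → ⟦ d ≟ˢ e ⟧) r (D ⊕ x)
  step x (yes _)  _         = z≤n
  step x (no _)   (no _)    = z≤n
  step x (no x∉D) (yes x∈e) = ℕ.*-monoʳ-≤ 1 (r!≤extensions e r (D ⊕ x)
    (λ y∈ → [ D⊆e , (λ { refl → x∈e }) ]′ (⊕⁻ y∈))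
    (trans eq (trans (ℕ.+-suc ∣ D ∣ r) (cong (_+ r) (sym (∣⊕∣ D x x∉D))))))

module Family {n} (E : List (Subset n)) where

  ext : ℕ → Subset n → ℕ
  ext = extensions λ D → ⟦ D ∈ˢ? E ⟧

  -- Likewise an ordered count, of the sets of size ∣ D ∣ + k above D in the shadow of E.
  shadow : ℕ → Subset n → ℕ
  shadow zero    D = positive (ext 1 D)
  shadow (suc k) D = ∑ λ x → ⟦ ¬? (x ∈? D) ⟧ * shadow k (D ⊕ x)

  -- Both counts are sums over the vertex added to D, so the inequality holds for one summand. A
  -- vertex of D contributes 0 to both sides.
  link : ∀ m k D → m * shadow (suc k) D < ext (2 + k) D →
         ∃[ x ] x ∉ D × m * shadow k (D ⊕ x) < ext (suc k) (D ⊕ x)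
  link m k D lt =
    let x , ltx = ∑-<⇒∃< (λ x → m * (⟦ ¬? (x ∈? D) ⟧ * shadow k (D ⊕ x)))
                         (λ x → ⟦ ¬? (x ∈? D) ⟧ * ext (suc k) (D ⊕ x))
                         (subst (_< ext (2 + k) D) (*-distribˡ-∑ m λ x → ⟦ ¬? (x ∈? D) ⟧ * shadow k (D ⊕ x)) lt)
    in  x , outside-D (x ∈? D) ltx
    where
    outside-D : ∀ {x a b} (d : Dec (x ∈ D)) → m * (⟦ ¬? d ⟧ * a) < ⟦ ¬? d ⟧ * b → x ∉ D × m * a < b
    outside-D (yes _) ()
    outside-D {a = a} {b} (no x∉D) lt =
      x∉D , subst₂ (λ a b → m * a < b) (ℕ.*-identityˡ a) (ℕ.*-identityˡ b) lt

  links : ∀ m j k D → m * shadow (j + k) D < ext (suc (j + k)) D →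
          ∃[ D′ ] ∣ D′ ∣ ≡ j + ∣ D ∣ × m * shadow k D′ < ext (suc k) D′
  links m zero    k D lt = D , refl , lt
  links m (suc j) k D lt with link m (j + k) D lt
  ... | x , x∉D , lt′ with links m j k (D ⊕ x) lt′
  ...   | D′ , eq , lt″ = D′ , trans eq (trans (cong (_+_ j) (∣⊕∣ D x x∉D)) (ℕ.+-suc j ∣ D ∣)) , lt″

  shadow≤ : ∀ k D → shadow k D ≤ (n ∸ ∣ D ∣) P′ k
  shadow≤ zero    D = ⟦⟧≤1 (0 ℕ.<? ext 1 D)
  shadow≤ (suc k) D = begin
    ∑ (λ x → ⟦ ¬? (x ∈? D) ⟧ * shadow k (D ⊕ x))               ≤⟨ ∑-mono (λ x → step x (x ∈? D)) ⟩
    ∑ (λ x → ⟦ ¬? (x ∈? D) ⟧ * (pred (n ∸ ∣ D ∣) P′ k))        ≡⟨ *-distribʳ-∑ (pred (n ∸ ∣ D ∣) P′ k) (λ x → ⟦ ¬? (x ∈? D) ⟧) ⟨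
    count (λ x → ¬? (x ∈? D)) * (pred (n ∸ ∣ D ∣) P′ k)        ≡⟨ cong (_* (pred (n ∸ ∣ D ∣) P′ k)) (count-∉? D) ⟩
    (n ∸ ∣ D ∣) * (pred (n ∸ ∣ D ∣) P′ k)                      ≡⟨ P′-suc (n ∸ ∣ D ∣) ⟨
    (n ∸ ∣ D ∣) P′ suc k                                       ∎
    where
    open ℕ.≤-Reasoning
    step : ∀ x (d : Dec (x ∈ D)) → ⟦ ¬? d ⟧ * shadow k (D ⊕ x) ≤ ⟦ ¬? d ⟧ * (pred (n ∸ ∣ D ∣) P′ k)
    step x (yes _)  = z≤n
    step x (no x∉D) = ℕ.*-monoʳ-≤ 1 (subst (λ m → shadow k (D ⊕ x) ≤ m P′ k)
      (trans (cong (n ∸_) (∣⊕∣ D x x∉D)) (sym (ℕ.pred[m∸n]≡m∸[1+n] n ∣ D ∣))) (shadow≤ k (D ⊕ x)))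
    P′-suc : ∀ m → m P′ suc k ≡ m * (pred m P′ k)
    P′-suc zero    = cong (_* (0 P′ k)) (ℕ.0∸n≡0 k)
    P′-suc (suc m) = nP′k≡n[n∸1P′k∸1] (suc m) (suc k)

-- Each edge is reached in `r !` orders, and since the list has no repetition, its indicator
-- dominates the sum of the indicators of its edges.
length*r!≤ext : ∀ {r} (E : List (Subset n)) → Uniqueˡ E → All (λ e → ∣ e ∣ ≡ r) E → length E * r ! ≤ Family.ext E r ⊥
length*r!≤ext []      _        _           = z≤n
length*r!≤ext {n} {r} (e ∷ E) (e∉ ∷ u) (∣e∣≡r ∷ size) = begin
  r ! + length E * r !                                          ≤⟨ ℕ.+-mono-≤
      (r!≤extensions e r ⊥ (λ x∈⊥ → contradiction x∈⊥ ∉⊥) (trans ∣e∣≡r (cong (_+ r) (sym (∣⊥∣≡0 n)))))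
      (length*r!≤ext E u size) ⟩
  extensions (λ d → ⟦ d ≟ˢ e ⟧) r ⊥ + Family.ext E r ⊥                 ≡⟨ extensions-+ (λ d → ⟦ d ≟ˢ e ⟧) _ r ⊥ ⟨
  extensions (λ d → ⟦ d ≟ˢ e ⟧ + ⟦ d ∈ˢ? E ⟧) r ⊥               ≤⟨ extensions-mono disjoint r ⊥ ⟩
  Family.ext (e ∷ E) r ⊥                                               ∎
  where
  open ℕ.≤-Reasoning
  disjoint : ∀ d → ⟦ d ≟ˢ e ⟧ + ⟦ d ∈ˢ? E ⟧ ≤ ⟦ d ∈ˢ? (e ∷ E) ⟧
  disjoint d = cases (d ≟ˢ e)
    where
    cases : (p : Dec (d ≡ e)) → ⟦ p ⟧ + ⟦ d ∈ˢ? E ⟧ ≤ ⟦ d ∈ˢ? (e ∷ E) ⟧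
    cases (no _)     = ⟦⟧-mono (d ∈ˢ? E) (d ∈ˢ? (e ∷ E)) there
    cases (yes refl) = ℕ.≤-reflexive (trans
      (cong suc (⟦⟧-false (d ∈ˢ? E) λ d∈E → All.lookup e∉ d∈E refl))
      (sym (⟦⟧-true (d ∈ˢ? (e ∷ E)) (here refl))))

nCk*k!≡nP′k : ∀ {n k} → k ≤ n → (n C k) * k ! ≡ n P′ k
nCk*k!≡nP′k {k = k} k≤n = trans
  (cong (_* k !) (trans (nCk≡nPk/k! k≤n)
    (cong (λ p → p ℕ./ k !) (trans (nPk≡n!/[n∸k]! k≤n) (sym (nP′k≡n!/[n∸k]! k≤n))))))
  (m/n*n≡m (k!∣nP′k k≤n))
  where
  instance _ = ℕ._!≢0 k

-- Multiplying by `k !` turns a violated bound into an inequality of ordered counts; all k-sets may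
-- be replaced by those in the shadow, as this only lowers the left side.
dense : ∀ {k} m (E : List (Subset n)) → Uniqueˡ E → All (λ e → ∣ e ∣ ≡ suc k) E → k ≤ n →
        m * (n C k) < length E * suc k → m * Family.shadow E k ⊥ < Family.ext E (suc k) ⊥
dense {n} {k} m E u size k≤n lt = begin-strict
  m * Family.shadow E k ⊥              ≤⟨ ℕ.*-monoʳ-≤ m (Family.shadow≤ E k ⊥) ⟩
  m * ((n ∸ ∣ ⊥ {n} ∣) P′ k)    ≡⟨ cong (λ d → m * ((n ∸ d) P′ k)) (∣⊥∣≡0 n) ⟩
  m * (n P′ k)                  ≡⟨ cong (m *_) (nCk*k!≡nP′k k≤n) ⟨
  m * ((n C k) * k !)           ≡⟨ ℕ.*-assoc m (n C k) (k !) ⟨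
  m * (n C k) * k !             <⟨ ℕ.*-monoˡ-< (k !) lt ⟩
  length E * suc k * k !        ≡⟨ ℕ.*-assoc (length E) (suc k) (k !) ⟩
  length E * (suc k !)          ≤⟨ length*r!≤ext E u size ⟩
  Family.ext E (suc k) ⊥               ∎
  where
  open ℕ.≤-Reasoning
  instance _ = ℕ._!≢0 k

-- Tight trees up to isomorphism

-- The labels of a pattern stand for the vertices outside a common part D of all edges.
Pattern : ℕ → Set
Pattern s = List (List (Fin s))

-- A left fold, so that for a concrete list of labels it reduces to `D ⊕ a ⊕ b`, the form in which
-- the edges occur below.
place : Subset n → Vec (Fin n) s → List (Fin s) → Subset n
place D ws = List.foldl (λ S i → S ⊕ Vec.lookup ws i) D

Fresh : Subset n → Vec (Fin n) s → Set
Fresh D ws = Unique ws × VecAll.All (_∉ D) ws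

Realized : List (Subset n) → Subset n → Pattern s → Set
Realized {n} {s} E D Π = Σ (Vec (Fin n) s) λ ws → Fresh D ws × All (λ π → place D ws π ∈ˡ E) Π

-- This concerns the link of E at D, whose edges have size `suc h`; m stands for one less than the
-- number of edges of the pattern.
Forced : ℕ → ℕ → Pattern s → Set
Forced m h Π = ∀ {n} (E : List (Subset n)) D → m * Family.shadow E h D < Family.ext E (suc h) D → Realized E D Π

starᵖ : ∀ s → Pattern s
starᵖ s = List.map (_∷ []) (List.allFin s)

path₃ᵖ : Pattern 4
path₃ᵖ = (0F ∷ 1F ∷ []) ∷ (1F ∷ 2F ∷ []) ∷ (2F ∷ 3F ∷ []) ∷ []

spiderᵖ : Pattern 5
spiderᵖ = (0F ∷ 1F ∷ []) ∷ (1F ∷ 2F ∷ []) ∷ (2F ∷ 3F ∷ []) ∷ (2F ∷ 4F ∷ []) ∷ []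

path₄ᵖ : Pattern 5
path₄ᵖ = (0F ∷ 1F ∷ []) ∷ (1F ∷ 2F ∷ []) ∷ (2F ∷ 3F ∷ []) ∷ (3F ∷ 4F ∷ []) ∷ []

star₃ᵖ : Pattern 6
star₃ᵖ = (0F ∷ 1F ∷ 2F ∷ []) ∷ (0F ∷ 1F ∷ 3F ∷ []) ∷ (0F ∷ 2F ∷ 4F ∷ []) ∷ (1F ∷ 2F ∷ 5F ∷ []) ∷ []

tight-pathᵖ : Pattern 6
tight-pathᵖ = (0F ∷ 1F ∷ 2F ∷ []) ∷ (1F ∷ 2F ∷ 3F ∷ []) ∷ (2F ∷ 3F ∷ 4F ∷ []) ∷ (3F ∷ 4F ∷ 5F ∷ []) ∷ []

-- Links as graphs and triple systems

⟦×⟧ : ∀ {P Q : Set} (p : Dec P) (q : Dec Q) → ⟦ p ×-dec q ⟧ ≡ ⟦ p ⟧ * ⟦ q ⟧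
⟦×⟧ (no _)  q = refl
⟦×⟧ (yes _) q = sym (ℕ.*-identityˡ ⟦ q ⟧)

positive-⟦⟧* : ∀ {P : Set} (p : Dec P) m → positive (⟦ p ⟧ * m) ≡ ⟦ p ⟧ * positive m
positive-⟦⟧* (no _)  m = refl
positive-⟦⟧* (yes _) m = trans (cong positive (ℕ.*-identityˡ m)) (sym (ℕ.*-identityˡ (positive m)))

∉⊕⁻ : ∀ {D : Subset n} {x y} → y ∉ D ⊕ x → y ∉ D × y ≢ x
∉⊕⁻ {D = D} y∉ = (y∉ ∘ ⊕⁺) , λ { refl → y∉ (x∈D⊕x {D = D}) }

module Link {n} (E : List (Subset n)) (D : Subset n) where

  open Family E
  A₁ : Fin n → Set
  A₁ x = x ∉ D × (D ⊕ x) ∈ˡ E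

  A₁? : ∀ x → Dec (A₁ x)
  A₁? x = ¬? (x ∈? D) ×-dec ((D ⊕ x) ∈ˢ? E)

  count-A₁ : count A₁? ≡ ext 1 D
  count-A₁ = ∑-cong λ x → ⟦×⟧ (¬? (x ∈? D)) ((D ⊕ x) ∈ˢ? E)

module Link₂ {n} (E : List (Subset n)) (D : Subset n) where

  open Family E

  -- Nesting the conditions makes the degrees follow the recursion of `ext` and `shadow`; symmetry
  -- is recovered afterwards.
  A₂ : Fin n → Fin n → Set
  A₂ x y = x ∉ D × Link.A₁ E (D ⊕ x) y

  A₂? : ∀ x y → Dec (A₂ x y)
  A₂? x y = ¬? (x ∈? D) ×-dec Link.A₁? E (D ⊕ x) y

  count-A₂ : ∀ x → count (A₂? x) ≡ ⟦ ¬? (x ∈? D) ⟧ * ext 1 (D ⊕ x)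
  count-A₂ x = trans (∑-cong λ y → ⟦×⟧ (¬? (x ∈? D)) (Link.A₁? E (D ⊕ x) y))
    (trans (sym (*-distribˡ-∑ ⟦ ¬? (x ∈? D) ⟧ (λ y → ⟦ Link.A₁? E (D ⊕ x) y ⟧)))
      (cong (⟦ ¬? (x ∈? D) ⟧ *_) (Link.count-A₁ E (D ⊕ x))))

  A₂-sym : ∀ {x y} → A₂ x y → A₂ y x
  A₂-sym {x} {y} (x∉ , y∉ , e) = let y∉D , y≢x = ∉⊕⁻ y∉ in
    y∉D , ∉⊕ x∉ (≢-sym y≢x) , subst (_∈ˡ E) (⊕-comm D x y) e

  A₂-irrefl : ∀ {x} → ¬ A₂ x x
  A₂-irrefl (_ , x∉ , _) = proj₂ (∉⊕⁻ x∉) refl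

  ∑-count-A₂ : ∑ (λ x → count (A₂? x)) ≡ ext 2 D
  ∑-count-A₂ = ∑-cong count-A₂

  ∑-positive-A₂ : ∑ (λ x → positive (count (A₂? x))) ≡ shadow 1 D
  ∑-positive-A₂ = ∑-cong λ x → trans (cong positive (count-A₂ x)) (positive-⟦⟧* (¬? (x ∈? D)) (ext 1 (D ⊕ x)))

  open Graph A₂? A₂-sym A₂-irrefl public

  large : ∀ m → m * shadow 1 D < ext 2 D → m * ∑ (positive ∘ deg) < ∑ deg
  large m = subst₂ (λ a b → m * a < b) (sym ∑-positive-A₂) (sym ∑-count-A₂)

module Link₃ {n} (E : List (Subset n)) (D : Subset n) where

  open Family E

  A₃ : Fin n → Fin n → Fin n → Set
  A₃ x y z = x ∉ D × Link₂.A₂ E (D ⊕ x) y z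

  A₃? : ∀ x y z → Dec (A₃ x y z)
  A₃? x y z = ¬? (x ∈? D) ×-dec Link₂.A₂? E (D ⊕ x) y z

  count-A₃ : ∀ x y → count (A₃? x y) ≡ ⟦ ¬? (x ∈? D) ⟧ * count (Link₂.A₂? E (D ⊕ x) y)
  count-A₃ x y = trans (∑-cong λ z → ⟦×⟧ (¬? (x ∈? D)) (Link₂.A₂? E (D ⊕ x) y z))
    (sym (*-distribˡ-∑ ⟦ ¬? (x ∈? D) ⟧ (λ z → ⟦ Link₂.A₂? E (D ⊕ x) y z ⟧)))

  swap₁₂ : ∀ {x y z} → A₃ x y z → A₃ y x z
  swap₁₂ {x} {y} {z} (x∉ , y∉ , z∉ , e) = let y∉D , y≢x = ∉⊕⁻ y∉ in
    y∉D , ∉⊕ x∉ (≢-sym y≢x) , subst (z ∉_) (⊕-comm D x y) z∉ , subst (λ F → F ⊕ z ∈ˡ E) (⊕-comm D x y) e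

  swap₂₃ : ∀ {x y z} → A₃ x y z → A₃ x z y
  swap₂₃ {x} (x∉ , a) = x∉ , Link₂.A₂-sym E (D ⊕ x) a

  A₃-irrefl : ∀ {x z} → ¬ A₃ x x z
  A₃-irrefl (_ , x∉ , _) = proj₂ (∉⊕⁻ x∉) refl

  ∑-count-A₃ : ∑ (λ x → ∑ λ y → count (A₃? x y)) ≡ ext 3 D
  ∑-count-A₃ = ∑-cong λ x → trans (∑-cong (count-A₃ x))
    (trans (sym (*-distribˡ-∑ ⟦ ¬? (x ∈? D) ⟧ (λ y → count (Link₂.A₂? E (D ⊕ x) y))))
      (cong (⟦ ¬? (x ∈? D) ⟧ *_) (Link₂.∑-count-A₂ E (D ⊕ x))))

  ∑-positive-A₃ : ∑ (λ x → ∑ λ y → positive (count (A₃? x y))) ≡ shadow 2 D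
  ∑-positive-A₃ = ∑-cong λ x → trans
    (∑-cong λ y → trans (cong positive (count-A₃ x y)) (positive-⟦⟧* (¬? (x ∈? D)) (count (Link₂.A₂? E (D ⊕ x) y))))
    (trans (sym (*-distribˡ-∑ ⟦ ¬? (x ∈? D) ⟧ (λ y → positive (count (Link₂.A₂? E (D ⊕ x) y)))))
      (cong (⟦ ¬? (x ∈? D) ⟧ *_) (Link₂.∑-positive-A₂ E (D ⊕ x))))

  open TripleSystem A₃? swap₁₂ swap₂₃ (λ {x} {z} → A₃-irrefl {x} {z}) public using (Star; TightPath; Large; star; tight-path)

  large : 3 * shadow 2 D < ext 3 D → Large
  large = subst₂ (λ a b → 3 * a < b) (sym ∑-positive-A₃) (sym ∑-count-A₃)

-- Dense links contain the patterns

star-forced : ∀ m → Forced m 0 (starᵖ (suc m))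
star-forced m E D lt =
  let ws , unique , edges = distinct (Link.A₁? E D) (suc m) (subst (m <_) (sym (Link.count-A₁ E D)) (many (ext-D) lt))
  in  ws , (unique , VecAll.map proj₁ edges)
    , map⁺ (All.universal (λ i → proj₂ (VecAllₚ.lookup⁺ edges i)) _)
  where
  ext-D = Family.ext E 1 D
  -- The strict inequality excludes d = 0, so the shadow indicator is 1.
  many : ∀ d → m * positive d < d → m < d
  many zero    lt = contradiction lt λ ()
  many (suc d) lt = subst (_< suc d) (ℕ.*-identityʳ m) lt

path₃-forced : Forced 2 1 path₃ᵖ
path₃-forced E D lt = realize (Link₂.path₃ E D (Link₂.large E D 2 lt))
  where
  realize : Link₂.Path₃ E D → Realized E D path₃ᵖ
  realize (a , x , y , b , unique , (a∉ , _ , ax) , (x∉ , _ , xy) , yb@(y∉ , _ , e)) =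
    a ∷ x ∷ y ∷ b ∷ [] , (unique , a∉ ∷ x∉ ∷ y∉ ∷ proj₁ (Link₂.A₂-sym E D yb) ∷ []) , ax ∷ xy ∷ e ∷ []

spider-forced : Forced 3 1 spiderᵖ
spider-forced E D lt = realize (Link₂.spider E D (Link₂.large E D 3 lt))
  where
  realize : Link₂.Spider E D → Realized E D spiderᵖ
  realize (a , x , y , b , c , unique , (a∉ , _ , ax) , (x∉ , _ , xy) , yb@(y∉ , _ , e) , yc@(_ , _ , e′)) =
    a ∷ x ∷ y ∷ b ∷ c ∷ []
    , (unique , a∉ ∷ x∉ ∷ y∉ ∷ proj₁ (Link₂.A₂-sym E D yb) ∷ proj₁ (Link₂.A₂-sym E D yc) ∷ [])
    , ax ∷ xy ∷ e ∷ e′ ∷ []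

path₄-forced : Forced 3 1 path₄ᵖ
path₄-forced E D lt = realize (Link₂.path₄ E D (Link₂.large E D 3 lt))
  where
  realize : Link₂.Path₄ E D → Realized E D path₄ᵖ
  realize (a , x , p , y , b , unique , (a∉ , _ , ax) , (x∉ , _ , xp) , (p∉ , _ , py) , yb@(y∉ , _ , e)) =
    a ∷ x ∷ p ∷ y ∷ b ∷ []
    , (unique , a∉ ∷ x∉ ∷ p∉ ∷ y∉ ∷ proj₁ (Link₂.A₂-sym E D yb) ∷ [])
    , ax ∷ xp ∷ py ∷ e ∷ []

star₃-forced : Forced 3 2 star₃ᵖ
star₃-forced E D lt = realize (Link₃.star E D (Link₃.large E D lt))
  where
  last : ∀ {x y z} → Link₃.A₃ E D x y z → z ∉ D
  last h = proj₁ (Link₃.swap₁₂ E D (Link₃.swap₂₃ E D h))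

  realize : Link₃.Star E D → Realized E D star₃ᵖ
  realize (x , y , z , a , b , c , unique , xyz@(x∉ , _ , _ , e) , xya@(_ , _ , _ , e₁) , xzb@(_ , _ , _ , e₂) , yzc@(y∉ , _ , _ , e₃)) =
    x ∷ y ∷ z ∷ a ∷ b ∷ c ∷ []
    , (unique , x∉ ∷ y∉ ∷ last xyz ∷ last xya ∷ last xzb ∷ last yzc ∷ [])
    , e ∷ e₁ ∷ e₂ ∷ e₃ ∷ []

tight-path-forced : Forced 3 2 tight-pathᵖ
tight-path-forced E D lt = realize (Link₃.tight-path E D (Link₃.large E D lt))
  where
  realize : Link₃.TightPath E D → Realized E D tight-pathᵖ
  realize (a , x , q , p , y , b , unique , (a∉ , _ , _ , e) , (x∉ , _ , _ , e₁) , (q∉ , _ , _ , e₂) , pyb@(p∉ , _ , _ , e₃)) =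
    a ∷ x ∷ q ∷ p ∷ y ∷ b ∷ []
    , (unique , a∉ ∷ x∉ ∷ q∉ ∷ p∉ ∷ proj₁ (Link₃.swap₁₂ E D pyb) ∷ proj₁ (Link₃.swap₁₂ E D (Link₃.swap₂₃ E D pyb)) ∷ [])
    , e ∷ e₁ ∷ e₂ ∷ e₃ ∷ []

-- Adding the edges of a tight tree one at a time

module _ {D : Subset n} {ws : Vec (Fin n) s} where

  fresh-∷ : ∀ {v} → v ∉ D → VecAll.All (v ≢_) ws → Fresh D ws → Fresh D (v ∷ ws)
  fresh-∷ v∉D v≢ws (unique , outside) = v≢ws ∷ unique , v∉D ∷ outside

  -- Used when a new edge omits the vertex p of the common part: p then becomes a label.
  fresh-split : ∀ {p} → p ∉ D → Fresh (D ⊕ p) ws → Fresh D (p ∷ ws)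
  fresh-split p∉D (unique , outside) = fresh-∷ p∉D
    (VecAll.map (λ w∉ → ≢-sym (proj₂ (∉⊕⁻ w∉))) outside) (unique , VecAll.map (proj₁ ∘ ∉⊕⁻) outside)

  -- Distinctness of the indices is checked by evaluation, so that a relabelling is given by listing
  -- σ.
  reorder : ∀ (σ : Vec (Fin s) t) {_ : True (allPairs? (λ i j → ¬? (i Fin.≟ j)) σ)} →
            Fresh D ws → Fresh D (Vec.map (Vec.lookup ws) σ)
  reorder σ {distinct} (unique , outside) =
    Unique.map⁺ (λ {i} {j} → Unique.lookup-injective unique i j) (toWitness distinct)
    , VecAllₚ.map⁺ (VecAll.universal (VecAllₚ.lookup⁺ outside) σ)

⊕-cancel : ∀ {F G : Subset n} {p} → p ∉ F → p ∉ G → F ⊕ p ≡ G ⊕ p → F ≡ G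
⊕-cancel p∉F p∉G eq = ⊆-antisym (half p∉F eq) (half p∉G (sym eq))
  where
  half : ∀ {F G : Subset _} {p} → p ∉ F → F ⊕ p ≡ G ⊕ p → F ⊆ G
  half {p = p} p∉F eq {x} x∈F with ⊕⁻ (subst (x ∈_) eq (⊕⁺ x∈F))
  ... | inj₁ x∈G = x∈G
  ... | inj₂ refl = contradiction x∈F p∉F

-- The vertex p dropped from the edge `D ⊕ a` is either the label a or a vertex of the common part,
-- which then shrinks to D′.
drop₁ : ∀ {F D : Subset n} {p a} → p ∉ F → a ∉ D → F ⊕ p ≡ D ⊕ a →
        F ≡ D ⊎ ∃[ D′ ] D ≡ D′ ⊕ p × p ∉ D′ × F ≡ D′ ⊕ a
drop₁ {F = F} {D} {p} {a} p∉F a∉D eq with ⊕⁻ (subst (p ∈_) eq (x∈D⊕x {D = F}))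
... | inj₂ refl = inj₁ (⊕-cancel p∉F a∉D eq)
... | inj₁ p∈D  = inj₂ (D - p , sym (-⊕ p∈D) , x∉p-x D p , ⊕-cancel p∉F
        (∉⊕ (x∉p-x D p) λ { refl → a∉D p∈D })
        (trans eq (trans (cong (_⊕ a) (sym (-⊕ p∈D))) (⊕-comm (D - p) p a))))

drop₂ : ∀ {F D : Subset n} {p a b} → p ∉ F → a ∉ D → b ∉ D ⊕ a → F ⊕ p ≡ D ⊕ a ⊕ b →
        F ≡ D ⊕ a ⊎ F ≡ D ⊕ b ⊎ ∃[ D′ ] D ≡ D′ ⊕ p × p ∉ D′ × F ≡ D′ ⊕ a ⊕ b
drop₂ p∉F a∉D b∉ eq with drop₁ p∉F b∉ eq
... | inj₁ F≡ = inj₁ F≡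
... | inj₂ (D₂ , eq₂ , p∉D₂ , refl) with drop₁ p∉D₂ a∉D (sym eq₂)
...   | inj₁ refl = inj₂ (inj₁ refl)
...   | inj₂ (D₁ , D≡ , p∉D₁ , refl) = inj₂ (inj₂ (D₁ , D≡ , p∉D₁ , refl))

⊕-rotate : ∀ (D : Subset n) a b c → D ⊕ a ⊕ b ⊕ c ≡ D ⊕ c ⊕ a ⊕ b
⊕-rotate D a b c = trans (⊕-comm (D ⊕ a) b c) (cong (_⊕ b) (⊕-comm D a c))

infix 4 _⊑_
_⊑_ : List (Subset n) → List (Subset n) → Set
L ⊑ M = All (_∈ˡ M) L

⊑-trans : ∀ {L M N : List (Subset n)} → L ⊑ M → M ⊑ N → L ⊑ N
⊑-trans L⊑M M⊑N = All.map (All.lookup M⊑N) L⊑M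

-- A step of a tight ordering, with the exchanged vertices p and v made explicit.
record Grows (L : List (Subset n)) (e : Subset n) : Set where
  constructor grows
  field
    {F}  : Subset n
    {p v} : Fin n
    old  : F ⊕ p ∈ˡ L
    p∉F  : p ∉ F
    new  : e ≡ F ⊕ v
    v∉   : All (v ∉_) L

Grows-resp : ∀ {L M : List (Subset n)} {e} → L ⊑ M → M ⊑ L → Grows L e → Grows M e
Grows-resp L⊑M M⊑L (grows old p∉F new v∉) =
  grows (All.lookup L⊑M old) p∉F new (All.map (All.lookup v∉) M⊑L)

record Joined {n s} (Π : Pattern s) (h r : ℕ) (L : List (Subset n)) : Set where
  constructor joined
  field
    D       : Subset n
    ws      : Vec (Fin n) s
    fresh   : Fresh D ws
    rank    : ∣ D ∣ + suc h ≡ r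
    covered : L ⊑ List.map (place D ws) Π

-- The inclusion `covered` serves the embedding of L; together with this converse, a further `Grows`
-- step on L can be read on the placed pattern.
Exact : {Π : Pattern s} {h r : ℕ} {L : List (Subset n)} → Joined Π h r L → Set
Exact {Π = Π} {L = L} J = List.map (place D ws) Π ⊑ L
  where open Joined J

record Classified {n} (m r : ℕ) (L : List (Subset n)) : Set where
  constructor classified
  field
    {arity height} : ℕ
    {Π}    : Pattern arity
    forced : Forced m height Π
    shape  : Joined Π height r L

rank-split : ∀ {D : Subset n} {p h r} → p ∉ D → ∣ D ⊕ p ∣ + suc h ≡ r → ∣ D ∣ + suc (suc h) ≡ r
rank-split {D = D} {p} {h} p∉D eq = trans (ℕ.+-suc ∣ D ∣ (suc h)) (trans (cong (_+ suc h) (sym (∣⊕∣ D p p∉D))) eq)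

module _ {r : ℕ} {n : ℕ} where

  start : ∀ {e : Subset n} → ∣ e ∣ ≡ r → 0 < r → Joined (starᵖ 1) 0 r (e ∷ [])
  start {e} eq 0<r with nonempty? e
  ... | no  empty     = contradiction 0<r (ℕ.≤⇒≯ (ℕ.≤-reflexive (trans (sym eq) (trans (cong ∣_∣ (Empty-unique empty)) (∣⊥∣≡0 n)))))
  ... | yes (p , p∈e) = joined (e - p) (p ∷ []) ([] ∷ [] , x∉p-x e p ∷ [])
    (trans (ℕ.+-comm ∣ e - p ∣ 1) (trans (∣p-x∣ p∈e) eq)) (here (sym (-⊕ p∈e)) ∷ [])

  pair : ∀ {e₁ e₂ : Subset n} → ∣ e₁ ∣ ≡ r → Grows (e₁ ∷ []) e₂ →
         Σ (Joined (starᵖ 2) 0 r (e₂ ∷ e₁ ∷ [])) Exact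
  pair eq (grows {F} {p} {v} (here refl) p∉F refl (v∉ ∷ [])) =
    joined F (v ∷ p ∷ []) (fresh-∷ (proj₁ (∉⊕⁻ v∉)) (proj₂ (∉⊕⁻ v∉) ∷ []) ([] ∷ [] , p∉F ∷ []))
      (trans (ℕ.+-comm ∣ F ∣ 1) (trans (sym (∣⊕∣ F p p∉F)) eq)) (here refl ∷ there (here refl) ∷ [])
    , here refl ∷ there (here refl) ∷ []

  Triple : List (Subset n) → Set
  Triple L = Σ (Joined (starᵖ 3) 0 r L) Exact ⊎ Σ (Joined path₃ᵖ 1 r L) Exact

  -- If the third edge keeps the common part D of the first two, the star grows. If it drops a
  -- vertex p of D, the edges form the path b p a v over the rest of D.
  triple : ∀ {L : List (Subset n)} {e} → Σ (Joined (starᵖ 2) 0 r L) Exact → Grows L e → Triple (e ∷ L)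
  triple {L} {e} (joined D (a ∷ b ∷ []) fresh rank covered , exact) g = cases (Grows-resp covered exact g)
    where
    branch : ∀ {D F : Subset n} {a b p v} → Fresh D (a ∷ b ∷ []) → ∣ D ∣ + 1 ≡ r → L ⊑ (D ⊕ a ∷ D ⊕ b ∷ []) →
             (D ⊕ a ∷ D ⊕ b ∷ []) ⊑ L → F ⊕ p ≡ D ⊕ a → p ∉ F → e ≡ F ⊕ v → v ∉ D ⊕ a → v ∉ D ⊕ b →
             Triple (e ∷ L)
    branch {D} {a = a} {b} {p} {v} fr@(_ , a∉D ∷ _) rank covered (ea ∷ eb ∷ []) eq p∉F refl v∉a v∉b with drop₁ p∉F a∉D eq
    ... | inj₁ refl = inj₁
      ( joined D (v ∷ a ∷ b ∷ []) (fresh-∷ (proj₁ (∉⊕⁻ v∉a)) (proj₂ (∉⊕⁻ v∉a) ∷ proj₂ (∉⊕⁻ v∉b) ∷ []) fr) rank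
          (here refl ∷ ⊑-trans covered (there (here refl) ∷ there (there (here refl)) ∷ []))
      , here refl ∷ there ea ∷ there eb ∷ [] )
    ... | inj₂ (D′ , refl , p∉D′ , refl) = inj₂
      ( joined D′ (b ∷ p ∷ a ∷ v ∷ [])
          (reorder (3F ∷ 1F ∷ 2F ∷ 0F ∷ []) (fresh-∷ (proj₁ (∉⊕⁻ v∉D)) (proj₂ (∉⊕⁻ v∉D) ∷ proj₂ (∉⊕⁻ v∉a) ∷ proj₂ (∉⊕⁻ v∉b) ∷ []) (fresh-split p∉D′ fr)))
          (rank-split p∉D′ rank)
          (there (there (here refl)) ∷ ⊑-trans covered (there (here refl) ∷ here (⊕-comm D′ p b) ∷ []))
      , there (subst (_∈ˡ L) (⊕-comm D′ p b) eb) ∷ there ea ∷ here refl ∷ [] )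
      where v∉D = proj₁ (∉⊕⁻ v∉a)

    cases : Grows (D ⊕ a ∷ D ⊕ b ∷ []) e → Triple (e ∷ L)
    cases (grows (here eq) p∉F new (v∉a ∷ v∉b ∷ [])) = branch fresh rank covered exact eq p∉F new v∉a v∉b
    cases (grows (there (here eq)) p∉F new (v∉a ∷ v∉b ∷ [])) = branch (reorder (1F ∷ 0F ∷ []) fresh) rank
      (⊑-trans covered (there (here refl) ∷ here refl ∷ []))
      (⊑-trans (there (here refl) ∷ here refl ∷ []) exact) eq p∉F new v∉b v∉a

  -- Keeping D gives the larger star. Dropping p from D makes p the vertex of degree 3 of a spider,
  -- whose long leg leads through a to v.
  star-step : ∀ {L : List (Subset n)} {e} → Σ (Joined (starᵖ 3) 0 r L) Exact → Grows L e → Classified 3 r (e ∷ L)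
  star-step {L} {e} (joined D (a ∷ b ∷ c ∷ []) fresh rank covered , exact) g = cases (Grows-resp covered exact g)
    where
    branch : ∀ {D F : Subset n} {a b c p v} → Fresh D (a ∷ b ∷ c ∷ []) → ∣ D ∣ + 1 ≡ r →
             L ⊑ (D ⊕ a ∷ D ⊕ b ∷ D ⊕ c ∷ []) → F ⊕ p ≡ D ⊕ a → p ∉ F → e ≡ F ⊕ v →
             v ∉ D ⊕ a → v ∉ D ⊕ b → v ∉ D ⊕ c → Classified 3 r (e ∷ L)
    branch {D} {a = a} {b} {c} {p} {v} fr@(_ , a∉D ∷ _) rank covered eq p∉F refl v∉a v∉b v∉c with drop₁ p∉F a∉D eq
    ... | inj₁ refl = classified (star-forced 3) (joined D (v ∷ a ∷ b ∷ c ∷ [])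
      (fresh-∷ (proj₁ (∉⊕⁻ v∉a)) (proj₂ (∉⊕⁻ v∉a) ∷ proj₂ (∉⊕⁻ v∉b) ∷ proj₂ (∉⊕⁻ v∉c) ∷ []) fr) rank
      (here refl ∷ ⊑-trans covered (there (here refl) ∷ there (there (here refl)) ∷ there (there (there (here refl))) ∷ [])))
    ... | inj₂ (D′ , refl , p∉D′ , refl) = classified spider-forced (joined D′ (v ∷ a ∷ p ∷ b ∷ c ∷ [])
      (reorder (0F ∷ 2F ∷ 1F ∷ 3F ∷ 4F ∷ []) (fresh-∷ (proj₁ (∉⊕⁻ v∉D))
        (proj₂ (∉⊕⁻ v∉D) ∷ proj₂ (∉⊕⁻ v∉a) ∷ proj₂ (∉⊕⁻ v∉b) ∷ proj₂ (∉⊕⁻ v∉c) ∷ []) (fresh-split p∉D′ fr)))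
      (rank-split p∉D′ rank)
      (here (⊕-comm D′ a v) ∷ ⊑-trans covered (there (here (⊕-comm D′ p a)) ∷ there (there (here refl)) ∷ there (there (there (here refl))) ∷ [])))
      where v∉D = proj₁ (∉⊕⁻ v∉a)

    cases : Grows (D ⊕ a ∷ D ⊕ b ∷ D ⊕ c ∷ []) e → Classified 3 r (e ∷ L)
    cases (grows (here eq) p∉F new (v∉a ∷ v∉b ∷ v∉c ∷ [])) = branch fresh rank covered eq p∉F new v∉a v∉b v∉c
    cases (grows (there (here eq)) p∉F new (v∉a ∷ v∉b ∷ v∉c ∷ [])) = branch (reorder (1F ∷ 0F ∷ 2F ∷ []) fresh) rank
      (⊑-trans covered (there (here refl) ∷ here refl ∷ there (there (here refl)) ∷ [])) eq p∉F new v∉b v∉a v∉c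
    cases (grows (there (there (here eq))) p∉F new (v∉a ∷ v∉b ∷ v∉c ∷ [])) = branch (reorder (2F ∷ 0F ∷ 1F ∷ []) fresh) rank
      (⊑-trans covered (there (here refl) ∷ there (there (here refl)) ∷ here refl ∷ [])) eq p∉F new v∉c v∉a v∉b

  -- On an end edge of the path, dropping its leaf gives a spider, dropping its other label the
  -- longer path, and dropping a common vertex the tight path. On the middle edge, dropping a label
  -- gives a spider and dropping a common vertex gives `star₃ᵖ`. The third edge is the first one of
  -- the reversed path.
  path-step : ∀ {L : List (Subset n)} {e} → Σ (Joined path₃ᵖ 1 r L) Exact → Grows L e → Classified 3 r (e ∷ L)
  path-step {L} {e} (joined D (b ∷ q ∷ a ∷ c ∷ []) fresh rank covered , exact) g = cases (Grows-resp covered exact g)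
    where
    M : Subset n → Fin n → Fin n → Fin n → Fin n → List (Subset n)
    M D b q a c = D ⊕ b ⊕ q ∷ D ⊕ q ⊕ a ∷ D ⊕ a ⊕ c ∷ []

    new-fresh : ∀ {D : Subset n} {b q a c v} → Fresh D (b ∷ q ∷ a ∷ c ∷ []) → All (v ∉_) (M D b q a c) →
                Fresh D (v ∷ b ∷ q ∷ a ∷ c ∷ [])
    new-fresh fr (v∉bq ∷ _ ∷ v∉ac ∷ []) =
      let v∉b , v≢q = ∉⊕⁻ v∉bq ; v∉D , v≢b = ∉⊕⁻ v∉b ; v∉a , v≢c = ∉⊕⁻ v∉ac ; _ , v≢a = ∉⊕⁻ v∉a
      in  fresh-∷ v∉D (v≢b ∷ v≢q ∷ v≢a ∷ v≢c ∷ []) fr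

    module _ {D : Subset n} {b q a c v} (fr : Fresh D (b ∷ q ∷ a ∷ c ∷ [])) (rank : ∣ D ∣ + 2 ≡ r)
             (covered : L ⊑ M D b q a c) (v∉ : All (v ∉_) (M D b q a c)) where

      spider-at-q : e ≡ D ⊕ q ⊕ v → Classified 3 r (e ∷ L)
      spider-at-q refl = classified spider-forced (joined D (c ∷ a ∷ q ∷ b ∷ v ∷ [])
        (reorder (4F ∷ 3F ∷ 2F ∷ 1F ∷ 0F ∷ []) (new-fresh fr v∉)) rank
        (there (there (there (here refl))) ∷ ⊑-trans covered
          (there (there (here (⊕-comm D b q))) ∷ there (here (⊕-comm D q a)) ∷ here (⊕-comm D a c) ∷ [])))

      spider-at-a : e ≡ D ⊕ a ⊕ v → Classified 3 r (e ∷ L)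
      spider-at-a refl = classified spider-forced (joined D (b ∷ q ∷ a ∷ c ∷ v ∷ [])
        (reorder (1F ∷ 2F ∷ 3F ∷ 4F ∷ 0F ∷ []) (new-fresh fr v∉)) rank
        (there (there (there (here refl))) ∷ ⊑-trans covered
          (here refl ∷ there (here refl) ∷ there (there (here refl)) ∷ [])))

    end : ∀ {D F : Subset n} {b q a c v p} → Fresh D (b ∷ q ∷ a ∷ c ∷ []) → ∣ D ∣ + 2 ≡ r → L ⊑ M D b q a c →
          F ⊕ p ≡ D ⊕ b ⊕ q → p ∉ F → e ≡ F ⊕ v → All (v ∉_) (M D b q a c) → Classified 3 r (e ∷ L)
    end {D} {F} {b} {q} {a} {c} {v} {p} fr@((b≢q ∷ _) ∷ _ , b∉D ∷ q∉D ∷ _) rank covered eq p∉F refl v∉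
      with drop₂ p∉F b∉D (∉⊕ q∉D (≢-sym b≢q)) eq
    ... | inj₁ refl = classified path₄-forced (joined D (v ∷ b ∷ q ∷ a ∷ c ∷ []) (new-fresh fr v∉) rank
      (here (⊕-comm D b v) ∷ ⊑-trans covered
        (there (here refl) ∷ there (there (here refl)) ∷ there (there (there (here refl))) ∷ [])))
    ... | inj₂ (inj₁ refl) = spider-at-q fr rank covered v∉ refl
    ... | inj₂ (inj₂ (D′ , refl , p∉D′ , refl)) = classified tight-path-forced (joined D′ (v ∷ b ∷ q ∷ p ∷ a ∷ c ∷ [])
      (reorder (1F ∷ 2F ∷ 3F ∷ 0F ∷ 4F ∷ 5F ∷ []) (fresh-split p∉D′ (new-fresh fr v∉))) (rank-split p∉D′ rank)
      (here (⊕-rotate D′ b q v) ∷ ⊑-trans covered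
        ( there (here (sym (⊕-rotate D′ b q p))) ∷ there (there (here (cong (_⊕ a) (⊕-comm D′ p q))))
        ∷ there (there (there (here refl))) ∷ [])))

    middle : ∀ {D F : Subset n} {b q a c v p} → Fresh D (b ∷ q ∷ a ∷ c ∷ []) → ∣ D ∣ + 2 ≡ r → L ⊑ M D b q a c →
             F ⊕ p ≡ D ⊕ q ⊕ a → p ∉ F → e ≡ F ⊕ v → All (v ∉_) (M D b q a c) → Classified 3 r (e ∷ L)
    middle {D} {F} {b} {q} {a} {c} {v} {p} fr@(_ ∷ (q≢a ∷ _) ∷ _ , _ ∷ q∉D ∷ a∉D ∷ _) rank covered eq p∉F refl v∉
      with drop₂ p∉F q∉D (∉⊕ a∉D (≢-sym q≢a)) eq
    ... | inj₁ refl        = spider-at-q fr rank covered v∉ refl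
    ... | inj₂ (inj₁ refl) = spider-at-a fr rank covered v∉ refl
    ... | inj₂ (inj₂ (D′ , refl , p∉D′ , refl)) = classified star₃-forced (joined D′ (p ∷ q ∷ a ∷ b ∷ c ∷ v ∷ [])
      (reorder (0F ∷ 3F ∷ 4F ∷ 2F ∷ 5F ∷ 1F ∷ []) (fresh-split p∉D′ (new-fresh fr v∉))) (rank-split p∉D′ rank)
      (there (there (there (here refl))) ∷ ⊑-trans covered
        (there (here (⊕-comm (D′ ⊕ p) b q)) ∷ here refl ∷ there (there (here refl)) ∷ [])))

    cases : Grows (M D b q a c) e → Classified 3 r (e ∷ L)
    cases (grows (here eq) p∉F new v∉) = end fresh rank covered eq p∉F new v∉
    cases (grows (there (here eq)) p∉F new v∉) = middle fresh rank covered eq p∉F new v∉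
    cases (grows (there (there (here eq))) p∉F new (v∉bq ∷ v∉qa ∷ v∉ac ∷ [])) =
      end (reorder (3F ∷ 2F ∷ 1F ∷ 0F ∷ []) fresh) rank
        (⊑-trans covered (there (there (here (⊕-comm D b q))) ∷ there (here (⊕-comm D q a)) ∷ here (⊕-comm D a c) ∷ []))
        (trans eq (⊕-comm D a c)) p∉F new
        (subst (_ ∉_) (⊕-comm D a c) v∉ac ∷ subst (_ ∉_) (⊕-comm D q a) v∉qa ∷ subst (_ ∉_) (⊕-comm D b q) v∉bq ∷ [])

-- Embedding a joined pattern

module _ (f : Fin k → Fin n) where

  ∈-image⁺ : ∀ {p x} → x ∈ p → f x ∈ image f p
  ∈-image⁺ {p} {x} x∈p = Vec.lookup⇒[]= (f x) _
    (trans (Vec.lookup∘tabulate _ (f x)) (dec-true (Fin.any? λ x′ → (x′ ∈? p) ×-dec (f x′ Fin.≟ f x)) (x , x∈p , refl)))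

  ∈-image⁻ : ∀ {p y} → y ∈ image f p → ∃[ x ] x ∈ p × f x ≡ y
  ∈-image⁻ {p} {y} y∈ = witness (Fin.any? λ x → (x ∈? p) ×-dec (f x Fin.≟ y))
    (trans (sym (Vec.lookup∘tabulate _ y)) (Vec.[]=⇒lookup y∈))
    where
    witness : ∀ {P : Set} (d : Dec P) → does d ≡ true → P
    witness (yes w) _ = w

  image-⊥ : image f ⊥ ≡ ⊥
  image-⊥ = Empty-unique λ (_ , y∈) → let _ , x∈⊥ , _ = ∈-image⁻ y∈ in ∉⊥ x∈⊥

  image-⊕ : ∀ p x → image f (p ⊕ x) ≡ image f p ⊕ f x
  image-⊕ p x = ⊆-antisym to from
    where
    to : image f (p ⊕ x) ⊆ image f p ⊕ f x
    to y∈ with ∈-image⁻ y∈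
    ... | z , z∈ , refl with ⊕⁻ z∈
    ...   | inj₁ z∈p  = ⊕⁺ (∈-image⁺ z∈p)
    ...   | inj₂ refl = x∈D⊕x {D = image f p}
    from : image f p ⊕ f x ⊆ image f (p ⊕ x)
    from y∈ with ⊕⁻ y∈
    ... | inj₂ refl = ∈-image⁺ (x∈D⊕x {D = p})
    ... | inj₁ y∈fp with ∈-image⁻ y∈fp
    ...   | z , z∈p , refl = ∈-image⁺ (⊕⁺ z∈p)

image-agree : ∀ {f g : Fin k → Fin n} p → (∀ {x} → x ∈ p → f x ≡ g x) → image f p ≡ image g p
image-agree {f = f} {g} p f≗g = ⊆-antisym (half f≗g) (half (sym ∘ f≗g))
  where
  half : ∀ {f g : Fin _ → Fin _} → (∀ {x} → x ∈ p → f x ≡ g x) → image f p ⊆ image g p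
  half {f} {g} f≗g y∈ with ∈-image⁻ f y∈
  ... | x , x∈p , refl = subst (_∈ image g p) (sym (f≗g x∈p)) (∈-image⁺ g x∈p)

-- The map is total but controlled only on S; its values elsewhere are provisional and get
-- overwritten by `extend`.
record Bijects (f : Fin k → Fin n) (S : Subset k) (S′ : Subset n) : Set where
  field
    injective : ∀ {x y} → x ∈ S → y ∈ S → f x ≡ f y → x ≡ y
    onto      : image f S ≡ S′

open Bijects

module _ {f : Fin k → Fin n} {S S′ u w} (bij : Bijects f S S′) (u∉S : u ∉ S) (w∉S′ : w ∉ S′) where

  private
    g : Fin k → Fin n
    g = updateAt f u (const w)

    g≡f : ∀ {x} → x ∈ S → g x ≡ f x
    g≡f {x} x∈S = updateAt-minimal x u f λ { refl → u∉S x∈S }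

    g-u : g u ≡ w
    g-u = updateAt-updates u f

    g≢w : ∀ {x} → x ∈ S → g x ≢ w
    g≢w x∈S eq = w∉S′ (subst₂ _∈_ (trans (sym (g≡f x∈S)) eq) (onto bij) (∈-image⁺ f x∈S))

  extend : ∃[ g ] Bijects g (S ⊕ u) (S′ ⊕ w) × (∀ {x} → x ∈ S → g x ≡ f x) × g u ≡ w
  extend = g , record
    { injective = inj
    ; onto      = trans (image-⊕ g S u) (cong₂ _⊕_ (trans (image-agree S g≡f) (onto bij)) g-u)
    } , g≡f , g-u
    where
    inj : ∀ {x y} → x ∈ S ⊕ u → y ∈ S ⊕ u → g x ≡ g y → x ≡ y
    inj x∈ y∈ eq with ⊕⁻ x∈ | ⊕⁻ y∈
    ... | inj₁ x∈S  | inj₁ y∈S  = injective bij x∈S y∈S (trans (sym (g≡f x∈S)) (trans eq (g≡f y∈S)))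
    ... | inj₁ x∈S  | inj₂ refl = contradiction (trans eq g-u) (g≢w x∈S)
    ... | inj₂ refl | inj₁ y∈S  = contradiction (trans (sym eq) g-u) (g≢w y∈S)
    ... | inj₂ refl | inj₂ refl = refl

∣p∣≡0⇒p≡⊥ : ∀ {p : Subset n} → ∣ p ∣ ≡ 0 → p ≡ ⊥
∣p∣≡0⇒p≡⊥ eq = Empty-unique λ (_ , x∈p) → contradiction (trans (∣p-x∣ x∈p) eq) λ ()

∣p∣≡1+m⇒nonempty : ∀ {p : Subset n} {m} → ∣ p ∣ ≡ suc m → ∃[ x ] x ∈ p
∣p∣≡1+m⇒nonempty {n} {p} eq with nonempty? p
... | yes ne = ne
... | no  em = contradiction (trans (sym eq) (trans (cong ∣_∣ (Empty-unique em)) (∣⊥∣≡0 n))) λ ()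

bijection : Fin n → ∀ m {S : Subset k} {S′ : Subset n} → ∣ S ∣ ≡ m → ∣ S′ ∣ ≡ m → ∃[ f ] Bijects f S S′
bijection {k = k} w₀ zero {S} {S′} eq eq′ with ∣p∣≡0⇒p≡⊥ {p = S} eq | ∣p∣≡0⇒p≡⊥ {p = S′} eq′
-- The vertex w₀ is only a default value for everything not yet placed.
... | refl | refl = const w₀ , record { injective = λ x∈⊥ → contradiction x∈⊥ ∉⊥ ; onto = image-⊥ {k = k} (const w₀) }
bijection w₀ (suc m) {S} {S′} eq eq′ with ∣p∣≡1+m⇒nonempty {p = S} eq | ∣p∣≡1+m⇒nonempty {p = S′} eq′
... | u , u∈S | w , w∈S′ with bijection w₀ m (ℕ.suc-injective (trans (∣p-x∣ u∈S) eq)) (ℕ.suc-injective (trans (∣p-x∣ w∈S′) eq′))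
...   | f , bij with extend bij (x∉p-x S u) (x∉p-x S′ w)
...     | g , bij′ , _ = g , subst₂ (Bijects g) (-⊕ u∈S) (-⊕ w∈S′) bij′

_⊕*_ : Subset n → Vec (Fin n) s → Subset n
D ⊕* []       = D
D ⊕* (w ∷ ws) = (D ⊕ w) ⊕* ws

∈-⊕*⁺ : ∀ {D : Subset n} (ws : Vec (Fin n) s) {x} → x ∈ D → x ∈ D ⊕* ws
∈-⊕*⁺ []       x∈D = x∈D
∈-⊕*⁺ (w ∷ ws) x∈D = ∈-⊕*⁺ ws (⊕⁺ x∈D)

lookup∈⊕* : ∀ {D : Subset n} (ws : Vec (Fin n) s) i → Vec.lookup ws i ∈ D ⊕* ws
lookup∈⊕* {D = D} (w ∷ ws) zero    = ∈-⊕*⁺ ws (x∈D⊕x {D = D})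
lookup∈⊕*         (w ∷ ws) (suc i) = lookup∈⊕* ws i

place⊆⊕* : ∀ {D : Subset n} (ws : Vec (Fin n) s) {S} → S ⊆ D ⊕* ws → ∀ π → place S ws π ⊆ D ⊕* ws
place⊆⊕* ws S⊆ []      = S⊆
place⊆⊕* ws S⊆ (i ∷ π) = place⊆⊕* ws (λ x∈ → [ S⊆ , (λ { refl → lookup∈⊕* ws i }) ]′ (⊕⁻ x∈)) π

fresh-tail : ∀ {D : Subset n} {w} {ws : Vec (Fin n) s} → Fresh D (w ∷ ws) → Fresh (D ⊕ w) ws
fresh-tail (w≢ ∷ unique , _ ∷ outside) =
  unique , VecAll.map (λ (w≢x , x∉) → ∉⊕ x∉ (≢-sym w≢x)) (VecAll.zip (w≢ , outside))

extend* : ∀ {f : Fin k → Fin n} {S S′} (us : Vec (Fin k) s) (ws : Vec (Fin n) s) → Bijects f S S′ →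
          Fresh S us → Fresh S′ ws →
          ∃[ g ] Bijects g (S ⊕* us) (S′ ⊕* ws) × (∀ {x} → x ∈ S → g x ≡ f x) ×
                 (∀ i → g (Vec.lookup us i) ≡ Vec.lookup ws i)
extend* {f = f} [] [] bij _ _ = f , bij , (λ _ → refl) , λ ()
extend* {S = S} (u ∷ us) (w ∷ ws) bij fresh-us@(_ , u∉S ∷ _) fresh-ws@(_ , w∉S′ ∷ _)
  with extend bij u∉S w∉S′
... | g , bij′ , g≡f , gu≡w with extend* us ws bij′ (fresh-tail fresh-us) (fresh-tail fresh-ws)
...   | h , bij″ , h≡g , h-us = h , bij″ , (λ x∈S → trans (h≡g (⊕⁺ x∈S)) (g≡f x∈S))
        , λ { zero → trans (h≡g (x∈D⊕x {D = S})) gu≡w ; (suc i) → h-us i }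

image-place : ∀ (f : Fin k → Fin n) {S S′} (us : Vec (Fin k) s) (ws : Vec (Fin n) s) → image f S ≡ S′ →
              (∀ i → f (Vec.lookup us i) ≡ Vec.lookup ws i) → ∀ π → image f (place S us π) ≡ place S′ ws π
image-place f us ws eq f-us []      = eq
image-place f us ws eq f-us (i ∷ π) = image-place f us ws
  (trans (image-⊕ f _ _) (cong₂ _⊕_ eq (f-us i))) f-us π

-- The common parts have equal size, so any bijection between them extends label by label. As the
-- edges cover T, every vertex lies in the controlled set, which makes the map injective everywhere.
joined⇒contains : ∀ {r h} {Π : Pattern s} (G : RGraph r n) (T : RGraph r k) → Fin n →
  (∀ v → ∃[ e ] e ∈ˡ edges T × v ∈ e) → (J : Joined Π h r (edges T)) →
  ∀ {D} → ∣ D ∣ ≡ ∣ Joined.D J ∣ → Realized (edges G) D Π → Contains G T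
joined⇒contains {n = n} {Π = Π} G T w₀ covers (joined D₀ us fresh-us _ covered) {D} eq (ws , fresh-ws , placed)
  with bijection w₀ ∣ D₀ ∣ refl eq
... | f , bij with extend* us ws bij fresh-us fresh-ws
...   | g , bij′ , g≡f , g-us =
  g , (λ {x} {y} → injective bij′ (everywhere x) (everywhere y)) , All.map maps covered
  where
  everywhere : ∀ v → v ∈ D₀ ⊕* us
  everywhere v with covers v
  ... | e , e∈T , v∈e with ∈-map⁻ (place D₀ us) (All.lookup covered e∈T)
  ...   | π , _ , refl = place⊆⊕* us (∈-⊕*⁺ us) π v∈e

  maps : ∀ {e} → e ∈ˡ List.map (place D₀ us) Π → image g e ∈ˡ edges G
  maps e∈ with ∈-map⁻ (place D₀ us) e∈
  ... | π , π∈Π , refl = subst (_∈ˡ edges G)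
    (sym (image-place g us ws (trans (image-agree D₀ g≡f) (onto bij)) g-us π)) (All.lookup placed π∈Π)

-- Classification of the tight trees with at most four edges

module _ {A : Set} {P : A → Set} where

  take-All : ∀ (xs : List A) m → (∀ j → Fin.toℕ j < m → P (List.lookup xs j)) → All P (List.take m xs)
  take-All xs       zero    _ = []
  take-All []       (suc m) _ = []
  take-All (x ∷ xs) (suc m) p = p zero (s≤s z≤n) ∷ take-All xs m λ j j<m → p (suc j) (s≤s j<m)

lookup∈take : ∀ {A : Set} (xs : List A) m j → Fin.toℕ j < m → List.lookup xs j ∈ˡ List.take m xs
lookup∈take (x ∷ xs) (suc m) zero    _         = here refl
lookup∈take (x ∷ xs) (suc m) (suc j) (s≤s j<m) = there (lookup∈take xs m j j<m)

-- The sets e and x have equal size, so x is `e - v` with one vertex p added; p is the exchanged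
-- vertex.
grow : ∀ {r} {L : List (Subset n)} {e x v} → ∣ e ∣ ≡ r → ∣ x ∣ ≡ r → x ∈ˡ L → v ∈ e → All (v ∉_) L →
       e - v ⊆ x → Grows L e
grow {e = e} {x} {v} e≡r x≡r x∈L v∈e v∉L e-v⊆x with Fin.any? (λ p → (p ∈? x) ×-dec ¬? (p ∈? (e - v)))
... | yes (p , p∈x , p∉) = grows (subst (_∈ˡ _) (sym F⊕p≡x) x∈L) p∉ (sym (-⊕ v∈e)) v∉L
  where
  F⊕p≡x : (e - v) ⊕ p ≡ x
  F⊕p≡x = ⊆∧∣≤∣⇒≡ (λ y∈ → [ e-v⊆x , (λ { refl → p∈x }) ]′ (⊕⁻ y∈))
    (ℕ.≤-reflexive (trans x≡r (trans (sym e≡r) (trans (sym (∣p-x∣ v∈e)) (sym (∣⊕∣ (e - v) p p∉))))))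
... | no none = contradiction (ℕ.≤-trans (ℕ.≤-reflexive (∣p-x∣ v∈e))
  (ℕ.≤-reflexive (trans e≡r (trans (sym x≡r) (cong ∣_∣ (sym e-v≡x)))))) (ℕ.<-irrefl refl)
  where
  x⊆ : x ⊆ e - v
  x⊆ {p} p∈x with p ∈? (e - v)
  ... | yes p∈ = p∈
  ... | no  p∉ = contradiction (p , p∈x , p∉) none
  e-v≡x : e - v ≡ x
  e-v≡x = ⊆-antisym e-v⊆x x⊆

module _ {r} {es : List (Subset n)} (tight : TightOrdering es) (sizes : All (λ e → ∣ e ∣ ≡ r) es) where

  tight-grows : ∀ i → 0 < Fin.toℕ i → Grows (List.take (Fin.toℕ i) es) (List.lookup es i)
  tight-grows i 0<i with TightOrdering.step tight i 0<i
  ... | v , s , v∈ , s<i , v∉ , e-v⊆ =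
    grow (All.lookup sizes (∈-lookup i)) (All.lookup sizes (∈-lookup s)) (lookup∈take es (Fin.toℕ i) s s<i)
      v∈ (take-All es (Fin.toℕ i) v∉) e-v⊆

weaken : ∀ {m r} {L M : List (Subset n)} → M ⊑ L → Classified m r L → Classified m r M
weaken M⊑L (classified forced (joined D ws fresh rank covered)) =
  classified forced (joined D ws fresh rank (⊑-trans M⊑L covered))

triple⇒classified : ∀ {r} {L : List (Subset n)} → Triple L → Classified 2 r L
triple⇒classified (inj₁ (J , _)) = classified (star-forced 2) J
triple⇒classified (inj₂ (J , _)) = classified path₃-forced J

classify : ∀ {r} (es : List (Subset n)) → TightOrdering es → All (λ e → ∣ e ∣ ≡ r) es → 0 < r → length es ≤ 4 →
           ∃[ m ] suc m ≡ length es × Classified m r es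
classify [] tight _ _ _ with TightOrdering.nonempty tight
... | ()
classify (e₀ ∷ []) _ (∣e₀∣ ∷ []) 0<r _ = 0 , refl , classified (star-forced 0) (start ∣e₀∣ 0<r)
classify (e₀ ∷ e₁ ∷ []) tight sizes@(∣e₀∣ ∷ _) _ _ = 1 , refl
  -- The steps put the newest edge in front, so the list has to be reversed.
  , weaken (there (here refl) ∷ here refl ∷ [])
      (classified (star-forced 1) (proj₁ (pair ∣e₀∣ (tight-grows tight sizes 1F (s≤s z≤n)))))
classify (e₀ ∷ e₁ ∷ e₂ ∷ []) tight sizes@(∣e₀∣ ∷ _) _ _ = 2 , refl
  , weaken (there (there (here refl)) ∷ there (here refl) ∷ here refl ∷ [])
      (triple⇒classified (triple (pair ∣e₀∣ (tight-grows tight sizes 1F (s≤s z≤n)))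
        (Grows-resp (there (here refl) ∷ here refl ∷ []) (there (here refl) ∷ here refl ∷ [])
          (tight-grows tight sizes 2F (s≤s z≤n)))))
classify {r = r} (e₀ ∷ e₁ ∷ e₂ ∷ e₃ ∷ []) tight sizes@(∣e₀∣ ∷ _) _ _ = 3 , refl
  , weaken (there (there (there (here refl))) ∷ there (there (here refl)) ∷ there (here refl) ∷ here refl ∷ [])
      (quadruple (triple (pair ∣e₀∣ (tight-grows tight sizes 1F (s≤s z≤n)))
        (Grows-resp (there (here refl) ∷ here refl ∷ []) (there (here refl) ∷ here refl ∷ [])
          (tight-grows tight sizes 2F (s≤s z≤n)))))
  where
  last : Grows (e₂ ∷ e₁ ∷ e₀ ∷ []) e₃
  last = Grows-resp (there (there (here refl)) ∷ there (here refl) ∷ here refl ∷ [])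
    (there (there (here refl)) ∷ there (here refl) ∷ here refl ∷ []) (tight-grows tight sizes 3F (s≤s z≤n))
  quadruple : Triple (e₂ ∷ e₁ ∷ e₀ ∷ []) → Classified 3 r (e₃ ∷ e₂ ∷ e₁ ∷ e₀ ∷ [])
  quadruple (inj₁ star) = star-step star last
  quadruple (inj₂ path) = path-step path last
classify (_ ∷ _ ∷ _ ∷ _ ∷ _ ∷ _) _ _ _ (s≤s (s≤s (s≤s (s≤s ()))))

-- The bound on the number of edges

classified⇒bound : ∀ {m r} → 0 < r → r ≤ n → (T : RGraph r k) → (∀ v → ∃[ e ] e ∈ˡ edges T × v ∈ e) →
  Classified m r (edges T) → (G : RGraph r n) → ¬ Contains G T → size G * r ≤ m * (n C (r ∸ 1))
classified⇒bound {n = n} {m = m} {r} 0<r r≤n T covers (classified {height = h} {Π} forced J) G free =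
  -- By `dense` and `links`, a larger G has a dense link at some set D′ of the size of D; there the
  -- pattern is forced, and T embeds along it.
  ℕ.≮⇒≥ λ lt → free (embed (dense m (edges G) (unique G) (subst (λ r → All (λ e → ∣ e ∣ ≡ r) (edges G)) r≡ (uniform G))
    (ℕ.≤-trans (ℕ.n≤1+n _) (subst (_≤ n) r≡ r≤n))
    (subst₂ (λ c r → m * (n C c) < size G * r) (cong (_∸ 1) r≡) r≡ lt)))
  where
  open Joined J using (D; rank)
  r≡ : r ≡ suc (∣ D ∣ + h)
  r≡ = trans (sym rank) (ℕ.+-suc ∣ D ∣ h)
  embed : m * Family.shadow (edges G) (∣ D ∣ + h) ⊥ < Family.ext (edges G) (suc (∣ D ∣ + h)) ⊥ → Contains G T
  embed lt with Family.links (edges G) m ∣ D ∣ h ⊥ lt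
  ... | D′ , eq , lt′ = joined⇒contains G T (Fin.fromℕ< (ℕ.≤-trans 0<r r≤n)) covers J
    (trans eq (trans (cong (_+_ ∣ D ∣) (∣⊥∣≡0 n)) (ℕ.+-identityʳ ∣ D ∣))) (forced (edges G) D′ lt′)

fraction-≤ : ∀ a m c r .{{_ : NonZero r}} → a * r ≤ m * c → (+ a / 1) ℚ.≤ (+ m / r) ℚ.* (+ c / 1)
fraction-≤ a m c (suc r) le = ℚ.toℚᵘ-cancel-≤ (begin
  ℚ.toℚᵘ (+ a / 1)                                     ≃⟨ ℚ.toℚᵘ-fromℚᵘ (ℚᵘ.mkℚᵘ (+ a) 0) ⟩
  ℚᵘ.mkℚᵘ (+ a) 0                                      ≤⟨ ℚᵘ.*≤* (subst₂ ℤ._≤_ lhs rhs (ℤ.+≤+ le)) ⟩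
  ℚᵘ.mkℚᵘ (+ m) r ℚᵘ.* ℚᵘ.mkℚᵘ (+ c) 0                 ≃⟨ ℚᵘ.*-cong (ℚ.toℚᵘ-fromℚᵘ (ℚᵘ.mkℚᵘ (+ m) r)) (ℚ.toℚᵘ-fromℚᵘ (ℚᵘ.mkℚᵘ (+ c) 0)) ⟨
  ℚ.toℚᵘ (+ m / suc r) ℚᵘ.* ℚ.toℚᵘ (+ c / 1)           ≃⟨ ℚ.toℚᵘ-homo-* (+ m / suc r) (+ c / 1) ⟨
  ℚ.toℚᵘ ((+ m / suc r) ℚ.* (+ c / 1))                 ∎)
  where
  open ℚᵘ.≤-Reasoning
  lhs : + (a * suc r) ≡ + a ℤ.* + (suc r * 1)
  lhs = trans (ℤ.pos-* a (suc r)) (cong (λ d → + a ℤ.* + d) (sym (ℕ.*-identityʳ (suc r))))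
  rhs : + (m * c) ≡ + m ℤ.* + c ℤ.* + 1
  rhs = trans (ℤ.pos-* m c) (sym (ℤ.*-identityʳ (+ m ℤ.* + c)))

theorem1p4 : (n r : ℕ) .{{_ : NonZero r}} → 2 ≤ r → r ≤ n →
    {k : ℕ} (T : RGraph r k) → IsTightTree T → size T ≤ 4 →
    (+ ex n T / 1) ℚ.≤ ((+ size T ℤ.- 1ℤ) / r) ℚ.* (+ (n C (r ∸ 1)) / 1)
theorem1p4 n r 2≤r r≤n T tree size≤4 = bound (classify ordering tightOrdering
    (All-resp-↭ (↭-sym ordering-↭) (uniform T)) 0<r (subst (_≤ 4) (sym ordering-length) size≤4))
  where
  open IsTightTree tree
  0<r : 0 < r
  0<r = ℕ.≤-trans (s≤s z≤n) 2≤r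
  ordering-length : length ordering ≡ size T
  ordering-length = ↭-length ordering-↭
  bound : ∃[ m ] suc m ≡ length ordering × Classified m r ordering → _
  -- The ordering has length `suc m`, so T has an edge and `ex n T` is attained by some G that does
  -- not contain T.
  bound (m , eq , cl) with ex-attained n T (subst (0 <_) (trans eq ordering-length) (s≤s z≤n))
  -- For t of the form `suc m`, the integer `+ t ℤ.- 1ℤ` computes to `+ m`.
  ... | G , size≡ex , free = subst (λ t → (+ ex n T / 1) ℚ.≤ ((+ t ℤ.- 1ℤ) / r) ℚ.* (+ (n C (r ∸ 1)) / 1))
    (trans eq ordering-length)
    (fraction-≤ (ex n T) m (n C (r ∸ 1)) r (subst (λ e → e * r ≤ m * (n C (r ∸ 1))) size≡ex
      (classified⇒bound 0<r r≤n T covered (weaken (All.tabulate (∈-resp-↭ (↭-sym ordering-↭))) cl) G free)))
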